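{- Let $c(N,d)$ denote the number of classes $C\subseteq\{\pm1\}^N$ with VC dimension $d$. For every $d>0$ there is $N_0=N_0(d)$ such that for all $N>N_0$, $$N^{(\Omega(N/d))^d}\leq c(N,d)\leq N^{(O(N))^d}.$$
   Context: The VC dimension of a class $C\subseteq\{\pm1\}^N$ is the maximum size of a set of coordinates $Y\subseteq[N]$ such that every pattern in $\{\pm1\}^Y$ is the restriction of some member of $C$ to $Y$. -}

module Defs where

open import Data.Bool using (Bool; true; false; _∧_; _∨_; not; if_then_else_)
open import Data.Nat using (ℕ; zero; suc; _⊔_; _≡ᵇ_)
open import Data.Product using (_×_; _,_)
open import Data.List using (List; []; _∷_; [_]; map; _++_; concatMap; foldr; length; filterᵇ)
open import Data.Vec using (Vec; []; _∷_)
open import Data.Fin.Subset using (Subset; ∣_∣)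
open import Data.Bool.ListAction using (all; any)

-- A point of {±1}^N: true encodes +1, false encodes -1.
Point : ℕ → Set
Point N = Vec Bool N

allPoints : (N : ℕ) → List (Point N)
allPoints zero = [ [] ]
allPoints (suc N) = map (true ∷_) (allPoints N) ++ map (false ∷_) (allPoints N)

-- A class C ⊆ {±1}^N, represented canonically as its characteristic
-- binary tree: Class 0 = whether the empty point is in C; a class on
-- N+1 coordinates is the pair (points with first coordinate +1,
-- points with first coordinate -1).  Distinct values = distinct classes.
Class : ℕ → Set
Class zero = Bool
Class (suc N) = Class N × Class N

_∈ᶜ_ : {N : ℕ} → Point N → Class N → Bool
[] ∈ᶜ b = b
(true ∷ x) ∈ᶜ (C₁ , C₂) = x ∈ᶜ C₁
(false ∷ x) ∈ᶜ (C₁ , C₂) = x ∈ᶜ C₂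

allClasses : (N : ℕ) → List (Class N)
allClasses zero = true ∷ false ∷ []
allClasses (suc N) = concatMap (λ a → map (a ,_) (allClasses N)) (allClasses N)

_==_ : Bool → Bool → Bool
true == b = b
false == b = not b

agreeOn : {N : ℕ} → Subset N → Point N → Point N → Bool
agreeOn [] [] [] = true
agreeOn (y ∷ Y) (a ∷ x) (b ∷ p) = (not y ∨ (a == b)) ∧ agreeOn Y x p

-- C shatters Y: every pattern on Y (= restriction of some p ∈ {±1}^N)
-- is the restriction to Y of some member of C.
shatters : {N : ℕ} → Class N → Subset N → Bool
shatters {N} C Y =
  all (λ p → any (λ x → (x ∈ᶜ C) ∧ agreeOn Y x p) (allPoints N)) (allPoints N)

allSubsets : (N : ℕ) → List (Subset N)
allSubsets = allPoints

-- VC dimension: the maximum size of a shattered set Y ⊆ [N]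
-- (the empty class gets 0; irrelevant since d > 0 below).
VCdim : {N : ℕ} → Class N → ℕ
VCdim {N} C = foldr _⊔_ 0 (map (λ Y → if shatters C Y then ∣ Y ∣ else 0) (allSubsets N))

c : ℕ → ℕ → ℕ
c N d = length (filterᵇ (λ C → VCdim C ≡ᵇ d) (allClasses N))

{-# OPTIONS --safe #-}
module Submission where

-- Upper bound.  A class C of VC dimension d is visited by a walk of length (O(N))^d in the cube
-- graph, and is therefore one of at most 2 (2N)^L classes, obtained by marking the points of a walk of
-- length L.  For d ≥ 2 the walk is built through k-separated nets M_k ⊆ C for k = N + 1, …, 1: a
-- point of M_k costs a detour of length 2k, so the total is O(Σ_k ∣M_k∣), and Haussler's packing
-- lemma ∣M_k∣ ≤ (O(N / k))^d makes the sum converge.  For d = 1 the sum would lose a factor log N;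
-- instead, some half {x ∈ C : x_i = b} is a single point, so the coordinate i can be erased at the
-- price of one detour of length 2.
--
-- Packing lemma.  The one-inclusion graph of a class of VC dimension d, with edge xy weighted by
-- min (w x) (w y), has total weight at most d Σ w.  Project a k-separated class to a random set I of
-- coordinates, each chosen with probability 4d / (4d + k).  If two points of C are in the same fibre,
-- they are k apart outside I, so a new coordinate splits the fibre well, and the edge bound forces
-- the projection to keep half of C on average; by Sauer–Shelah it has few points.
--
-- Lower bound.  Split off d blocks of E = 2e + 2 coordinates, leaving M ≥ N / 2 coordinates.  For each
-- function f from the E^d choices of one coordinate per block to the M remaining coordinates, the
-- class {e_{i₁} … e_{i_d} e_{f(i)}} has VC dimension d.

open import Defs
open import Data.Bool using (Bool; true; false; not; _∧_; _∨_; if_then_else_; T)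
open import Data.Bool.ListAction using (all; any)
open import Data.Bool.Properties using (T-≡; ∨-zeroʳ; ∧-zeroʳ; ∧-identityʳ; not-¬; ¬-not) renaming (_≟_ to _≟ᵇ_)
open import Data.Empty using (⊥; ⊥-elim)
open import Data.Fin using (Fin; zero; suc)
open import Data.Fin.Subset using (Subset; ∣_∣)
open import Data.List using (List; []; _∷_; _++_; length; map; filter; allFin; foldr; concatMap; cartesianProduct; cartesianProductWith)
open import Data.List.Membership.Propositional using (_∈_; lose; find)
open import Data.List.Membership.Propositional.Properties using (∈-map⁺; ∈-map⁻; ∈-++⁺ˡ; ∈-++⁺ʳ; ∈-allFin; ∈-cartesianProductWith⁺; ∈-cartesianProductWith⁻; ∈-cartesianProduct⁺; ∈-filter⁺; ∈-filter⁻)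
open import Data.List.Properties using (length-++; length-map; length-tabulate)
open import Data.List.Relation.Unary.All as All using (All; []; _∷_; all?)
open import Data.List.Relation.Unary.All.Properties using (¬All⇒Any¬)
open import Data.List.Relation.Unary.AllPairs as AllPairs using (AllPairs; []; _∷_)
open import Data.List.Relation.Unary.Any using (here; there; any?)
open import Data.List.Relation.Unary.Unique.Propositional using (Unique)
open import Data.List.Relation.Unary.Unique.Propositional.Properties using (cartesianProduct⁺; cartesianProductWith⁺; map⁺; allFin⁺) renaming (filter⁺ to unique-filter⁺)
open import Data.Nat using (ℕ; zero; suc; _+_; _*_; _^_; _∸_; _⊔_; _⊓_; ⌊_/2⌋; ⌈_/2⌉; _≤_; _<_; z≤n; s≤s; z<s; s≤s⁻¹; _≤?_; _<?_; _≤ᵇ_; _≡ᵇ_; NonZero; >-nonZero; >-nonZero⁻¹)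
open import Data.Nat.Properties
open import Data.Nat.Tactic.RingSolver using (solve-∀)
open import Data.Product using (∃; _×_; _,_; proj₁; proj₂)
open import Data.Sum using (_⊎_; inj₁; inj₂)
open import Data.Unit using (⊤; tt)
open import Data.Vec using (Vec; []; _∷_; replicate; lookup; _[_]≔_; splitAt) renaming (_++_ to _++ⱽ_; map to mapⱽ)
open import Data.Vec.Properties using (≡-dec; ∷-injective; ∷-injectiveʳ; lookup∘update; lookup∘update′; lookup-replicate)
open import Function using (_∘_; id; Equivalence)
open import Relation.Binary.PropositionalEquality using (_≡_; _≢_; refl; sym; trans; cong; cong₂; subst; subst₂; module ≡-Reasoning)
open import Relation.Nullary using (Dec; yes; no; ¬_; does)
open import Relation.Nullary.Decidable using (_→-dec_; _×-dec_; ¬?; T?; dec-true)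

private
  variable
    n : ℕ

-- Shattering

Agree : Subset n → Point n → Point n → Set
Agree [] _ _ = ⊤
Agree (true ∷ Y) (a ∷ x) (b ∷ p) = a ≡ b × Agree Y x p
Agree (false ∷ Y) (_ ∷ x) (_ ∷ p) = Agree Y x p

Shatters : (Point n → Set) → Subset n → Set
Shatters P Y = ∀ p → ∃ λ x → P x × Agree Y x p

VC≤ : ℕ → (Point n → Set) → Set
VC≤ d P = ∀ Y → Shatters P Y → ∣ Y ∣ ≤ d

VC≤-antitone : ∀ {d} {P Q : Point n → Set} → (∀ {x} → Q x → P x) → VC≤ d P → VC≤ d Q
VC≤-antitone Q⊆P vc Y sh = vc Y λ p → let x , Qx , ag = sh p in x , Q⊆P Qx , ag

-- Leaving the first coordinate out of the set makes its value irrelevant, so either half may supply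
-- the pattern.
VC≤-∪ : ∀ {d} {P : Point (suc n) → Set} → VC≤ d P →
        VC≤ d (λ x → P (true ∷ x) ⊎ P (false ∷ x))
VC≤-∪ {n} {d} {P} vc Y sh = vc (false ∷ Y) lifted
  where
  lifted : Shatters P (false ∷ Y)
  lifted (_ ∷ p) with sh p
  ... | x , inj₁ Px , ag = true ∷ x , Px , ag
  ... | x , inj₂ Px , ag = false ∷ x , Px , ag

-- A common point of the two halves realises its pattern with either value of the first coordinate,
-- so intersecting the halves costs one dimension.
shatters-∩ : ∀ {P : Point (suc n) → Set} {Y} →
             Shatters (λ x → P (true ∷ x) × P (false ∷ x)) Y → Shatters P (true ∷ Y)
shatters-∩ sh (true ∷ p) = let x , (Px , _) , ag = sh p in true ∷ x , Px , refl , ag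
shatters-∩ sh (false ∷ p) = let x , (_ , Px) , ag = sh p in false ∷ x , Px , refl , ag

VC≤-∩ : ∀ {d} {P : Point (suc n) → Set} → VC≤ (suc d) P →
        VC≤ d (λ x → P (true ∷ x) × P (false ∷ x))
VC≤-∩ {P = P} vc Y sh = s≤s⁻¹ (vc (true ∷ Y) (shatters-∩ {P = P} sh))

agree-∅ : (x p : Point n) → Agree (replicate n false) x p
agree-∅ [] [] = tt
agree-∅ (_ ∷ x) (_ ∷ p) = agree-∅ x p

-- A common point shatters the empty set of remaining coordinates, hence the first coordinate would
-- be shattered by `P`.
VC≤0-∩ : ∀ {P : Point (suc n) → Set} → VC≤ 0 P → ∀ x → P (true ∷ x) → P (false ∷ x) → ⊥
VC≤0-∩ {n} {P} vc x Pt Pf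
  with () ← vc (true ∷ replicate n false)
                (shatters-∩ {P = P} λ p → x , (Pt , Pf) , agree-∅ x p)

-- Sums over the cube

Σₚ : ∀ n → (Point n → ℕ) → ℕ
Σₚ zero f = f []
Σₚ (suc n) f = Σₚ n (λ x → f (true ∷ x)) + Σₚ n (λ x → f (false ∷ x))

Σₚ-mono : ∀ n {f g : Point n → ℕ} → (∀ x → f x ≤ g x) → Σₚ n f ≤ Σₚ n g
Σₚ-mono zero f≤g = f≤g []
Σₚ-mono (suc n) f≤g = +-mono-≤ (Σₚ-mono n (f≤g ∘ (true ∷_))) (Σₚ-mono n (f≤g ∘ (false ∷_)))

Σₚ-cong : ∀ n {f g : Point n → ℕ} → (∀ x → f x ≡ g x) → Σₚ n f ≡ Σₚ n g
Σₚ-cong zero f≡g = f≡g []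
Σₚ-cong (suc n) f≡g = cong₂ _+_ (Σₚ-cong n (f≡g ∘ (true ∷_))) (Σₚ-cong n (f≡g ∘ (false ∷_)))

Σₚ-zero : ∀ n → Σₚ n (λ _ → 0) ≡ 0
Σₚ-zero zero = refl
Σₚ-zero (suc n) = cong₂ _+_ (Σₚ-zero n) (Σₚ-zero n)

interchange : ∀ a b c d → (a + b) + (c + d) ≡ (a + c) + (b + d)
interchange = solve-∀

Σₚ-+ : ∀ n (f g : Point n → ℕ) → Σₚ n (λ x → f x + g x) ≡ Σₚ n f + Σₚ n g
Σₚ-+ zero f g = refl
Σₚ-+ (suc n) f g = trans
  (cong₂ _+_ (Σₚ-+ n (f ∘ (true ∷_)) (g ∘ (true ∷_))) (Σₚ-+ n (f ∘ (false ∷_)) (g ∘ (false ∷_))))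
  (interchange (Σₚ n (f ∘ (true ∷_))) _ _ _)

Σₚ-* : ∀ n k (f : Point n → ℕ) → Σₚ n (λ x → k * f x) ≡ k * Σₚ n f
Σₚ-* zero k f = refl
Σₚ-* (suc n) k f = trans
  (cong₂ _+_ (Σₚ-* n k (f ∘ (true ∷_))) (Σₚ-* n k (f ∘ (false ∷_))))
  (sym (*-distribˡ-+ k (Σₚ n (f ∘ (true ∷_))) _))

-- Weighted one-inclusion graphs

⊔+⊓ : ∀ a b → (a ⊔ b) + (a ⊓ b) ≡ a + b
⊔+⊓ zero b = +-identityʳ b
⊔+⊓ (suc a) zero = refl
⊔+⊓ (suc a) (suc b) = cong suc (trans (+-suc (a ⊔ b) (a ⊓ b)) (trans (cong suc (⊔+⊓ a b)) (sym (+-suc a b))))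

Supp : (Point n → ℕ) → Point n → Set
Supp w x = 0 < w x

0<⊔ : ∀ a b → 0 < a ⊔ b → 0 < a ⊎ 0 < b
0<⊔ zero b q = inj₂ q
0<⊔ (suc a) b q = inj₁ z<s

0<⊓ : ∀ a b → 0 < a ⊓ b → 0 < a × 0 < b
0<⊓ a b q = ≤-trans q (m⊓n≤m a b) , ≤-trans q (m⊓n≤n a b)

module _ (w : Point (suc n) → ℕ) where
  private
    u v : Point n → ℕ
    u x = w (true ∷ x)
    v x = w (false ∷ x)

  VC≤-⊔ : ∀ {d} → VC≤ d (Supp w) → VC≤ d (Supp λ x → u x ⊔ v x)
  VC≤-⊔ vc = VC≤-antitone (λ {x} → 0<⊔ (u x) (v x)) (VC≤-∪ {P = Supp w} vc)

  VC≤-⊓ : ∀ {d} → VC≤ (suc d) (Supp w) → VC≤ d (Supp λ x → u x ⊓ v x)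
  VC≤-⊓ vc = VC≤-antitone (λ {x} → 0<⊓ (u x) (v x)) (VC≤-∩ {P = Supp w} vc)

  VC≤0-⊓ : VC≤ 0 (Supp w) → ∀ x → u x ⊓ v x ≡ 0
  VC≤0-⊓ vc x with u x ⊓ v x in eq
  ... | zero = refl
  ... | suc m with p , q ← 0<⊓ (u x) (v x) (subst (0 <_) (sym eq) (s≤s z≤n)) =
    ⊥-elim (VC≤0-∩ {P = Supp w} vc x p q)

-- The total edge weight of the one-inclusion graph on the support of `w`: an edge with an endpoint
-- outside the support weighs 0.
edges : ∀ n → (Point n → ℕ) → ℕ
edges zero w = 0
edges (suc n) w = edges n (λ x → w (true ∷ x)) + edges n (λ x → w (false ∷ x))
                + Σₚ n (λ x → w (true ∷ x) ⊓ w (false ∷ x))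

-- By `⊔+⊓` the left side is the maximum plus the minimum of `a ⊓ b` and `c ⊓ d`, and these are
-- bounded separately by the two terms on the right.
⊓-supermodular : ∀ a b c d → (a ⊓ b) + (c ⊓ d) ≤ ((a ⊔ c) ⊓ (b ⊔ d)) + ((a ⊓ c) ⊓ (b ⊓ d))
⊓-supermodular a b c d = ≤-trans (≤-reflexive (sym (⊔+⊓ (a ⊓ b) (c ⊓ d)))) (+-mono-≤
  (⊔-lub (⊓-mono-≤ (m≤m⊔n a c) (m≤m⊔n b d)) (⊓-mono-≤ (m≤n⊔m a c) (m≤n⊔m b d)))
  (⊓-glb (⊓-mono-≤ (m⊓n≤m a b) (m⊓n≤m c d)) (⊓-mono-≤ (m⊓n≤n a b) (m⊓n≤n c d))))

edges-supermodular : ∀ n (u v : Point n → ℕ) →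
  edges n u + edges n v ≤ edges n (λ x → u x ⊔ v x) + edges n (λ x → u x ⊓ v x)
edges-supermodular zero u v = z≤n
edges-supermodular (suc n) u v = begin
  (a₁ + a₂ + Σₚ n _) + (b₁ + b₂ + Σₚ n _)
    ≡⟨ shuffle a₁ a₂ _ b₁ b₂ _ ⟩
  (a₁ + b₁) + (a₂ + b₂) + (Σₚ n _ + Σₚ n _)
    ≡⟨ cong ((a₁ + b₁) + (a₂ + b₂) +_) (Σₚ-+ n _ _) ⟨
  (a₁ + b₁) + (a₂ + b₂) + Σₚ n _
    ≤⟨ +-mono-≤ (+-mono-≤ (edges-supermodular n _ _) (edges-supermodular n _ _))
                (Σₚ-mono n λ x → ⊓-supermodular (u (true ∷ x)) (u (false ∷ x)) (v (true ∷ x)) (v (false ∷ x))) ⟩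
  (j₁ + m₁) + (j₂ + m₂) + Σₚ n _
    ≡⟨ cong ((j₁ + m₁) + (j₂ + m₂) +_) (Σₚ-+ n _ _) ⟩
  (j₁ + m₁) + (j₂ + m₂) + (Σₚ n _ + Σₚ n _)
    ≡⟨ shuffle j₁ j₂ _ m₁ m₂ _ ⟨
  (j₁ + j₂ + Σₚ n _) + (m₁ + m₂ + Σₚ n _) ∎
  where
  open ≤-Reasoning
  a₁ = edges n (u ∘ (true ∷_))
  a₂ = edges n (u ∘ (false ∷_))
  b₁ = edges n (v ∘ (true ∷_))
  b₂ = edges n (v ∘ (false ∷_))
  j₁ = edges n (λ x → u (true ∷ x) ⊔ v (true ∷ x))
  j₂ = edges n (λ x → u (false ∷ x) ⊔ v (false ∷ x))
  m₁ = edges n (λ x → u (true ∷ x) ⊓ v (true ∷ x))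
  m₂ = edges n (λ x → u (false ∷ x) ⊓ v (false ∷ x))
  shuffle : ∀ a b c d e f → (a + b + c) + (d + e + f) ≡ (a + d) + (b + e) + (c + f)
  shuffle = solve-∀

Σₚ-⊔⊓ : ∀ n (u v : Point n → ℕ) →
        Σₚ n (λ x → u x ⊔ v x) + Σₚ n (λ x → u x ⊓ v x) ≡ Σₚ n u + Σₚ n v
Σₚ-⊔⊓ n u v = trans (sym (Σₚ-+ n _ _)) (trans (Σₚ-cong n λ x → ⊔+⊓ (u x) (v x)) (Σₚ-+ n u v))

-- Replacing the two halves u, v of w by u ⊔ v and u ⊓ v does not lose edges inside the halves,
-- and the support of u ⊓ v has smaller VC dimension, which pays for the edges across.
edges-bound : ∀ n d (w : Point n → ℕ) → VC≤ d (Supp w) → edges n w ≤ d * Σₚ n w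
edges-bound zero d w vc = z≤n
edges-bound (suc n) d w vc = begin
  edges n u + edges n v + Σₚ n m
    ≤⟨ +-monoˡ-≤ (Σₚ n m) (edges-supermodular n u v) ⟩
  edges n j + edges n m + Σₚ n m
    ≡⟨ +-assoc (edges n j) _ _ ⟩
  edges n j + (edges n m + Σₚ n m)
    ≤⟨ +-mono-≤ (edges-bound n d j (VC≤-⊔ w vc)) (meet d vc) ⟩
  d * Σₚ n j + d * Σₚ n m
    ≡⟨ *-distribˡ-+ d (Σₚ n j) _ ⟨
  d * (Σₚ n j + Σₚ n m)
    ≡⟨ cong (d *_) (Σₚ-⊔⊓ n u v) ⟩
  d * (Σₚ n u + Σₚ n v) ∎
  where
  open ≤-Reasoning
  u v j m : Point n → ℕ
  u x = w (true ∷ x)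
  v x = w (false ∷ x)
  j x = u x ⊔ v x
  m x = u x ⊓ v x
  meet : ∀ d → VC≤ d (Supp w) → edges n m + Σₚ n m ≤ d * Σₚ n m
  -- Dimension 0 leaves nothing to subtract from; instead the two halves are disjoint, so `m`
  -- vanishes identically.
  meet zero vc = begin
    edges n m + Σₚ n m  ≤⟨ +-monoˡ-≤ _ (edges-bound n 0 m (VC≤-antitone (λ {x} q → ⊥-elim (n≮0 (subst (0 <_) (VC≤0-⊓ w vc x) q))) (VC≤-⊔ w vc))) ⟩
    Σₚ n m              ≡⟨ trans (Σₚ-cong n (VC≤0-⊓ w vc)) (Σₚ-zero n) ⟩
    0                   ∎
  meet (suc d) vc = begin
    edges n m + Σₚ n m      ≤⟨ +-monoˡ-≤ _ (edges-bound n d m (VC≤-⊓ w vc)) ⟩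
    d * Σₚ n m + Σₚ n m     ≡⟨ +-comm (d * Σₚ n m) _ ⟩
    suc d * Σₚ n m          ∎

-- The Sauer–Shelah lemma

-- The sum of the binomial coefficients C(n, i) over i ≤ d, computed by Pascal's rule.
sauer : ℕ → ℕ → ℕ
sauer zero d = 1
sauer (suc n) zero = sauer n zero
sauer (suc n) (suc d) = sauer n (suc d) + sauer n d

∣supp∣ : ∀ n → (Point n → ℕ) → ℕ
∣supp∣ n w = Σₚ n (λ x → 1 ⊓ w x)

∣supp∣-⊔⊓ : ∀ n (u v : Point n → ℕ) →
  ∣supp∣ n u + ∣supp∣ n v ≡ ∣supp∣ n (λ x → u x ⊔ v x) + ∣supp∣ n (λ x → u x ⊓ v x)
∣supp∣-⊔⊓ n u v = trans (sym (Σₚ-+ n _ _)) (trans (Σₚ-cong n λ x → pointwise (u x) (v x)) (Σₚ-+ n _ _))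
  where
  pointwise : ∀ a b → 1 ⊓ a + 1 ⊓ b ≡ 1 ⊓ (a ⊔ b) + 1 ⊓ (a ⊓ b)
  pointwise zero b = sym (+-identityʳ _)
  pointwise (suc a) zero = refl
  pointwise (suc a) (suc b) = refl

-- The halves have together as many support points as their union and intersection, whose dimensions
-- are at most d and d - 1; this matches Pascal's rule.
∣supp∣≤sauer : ∀ n d (w : Point n → ℕ) → VC≤ d (Supp w) → ∣supp∣ n w ≤ sauer n d
∣supp∣≤sauer zero d w vc = m⊓n≤m 1 (w [])
∣supp∣≤sauer (suc n) zero w vc = begin
  ∣supp∣ n u + ∣supp∣ n v  ≡⟨ ∣supp∣-⊔⊓ n u v ⟩
  ∣supp∣ n j + ∣supp∣ n m  ≡⟨ cong (∣supp∣ n j +_) (trans (Σₚ-cong n λ x → cong (1 ⊓_) (VC≤0-⊓ w vc x)) (Σₚ-zero n)) ⟩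
  ∣supp∣ n j + 0           ≡⟨ +-identityʳ _ ⟩
  ∣supp∣ n j               ≤⟨ ∣supp∣≤sauer n zero j (VC≤-⊔ w vc) ⟩
  sauer n zero             ∎
  where
  open ≤-Reasoning
  u v j m : Point n → ℕ
  u x = w (true ∷ x)
  v x = w (false ∷ x)
  j x = u x ⊔ v x
  m x = u x ⊓ v x
∣supp∣≤sauer (suc n) (suc d) w vc = ≤-trans
  (≤-reflexive (∣supp∣-⊔⊓ n (λ x → w (true ∷ x)) (λ x → w (false ∷ x))))
  (+-mono-≤ (∣supp∣≤sauer n (suc d) _ (VC≤-⊔ w vc)) (∣supp∣≤sauer n d _ (VC≤-⊓ w vc)))

-- Projections

restrict : (I : Subset n) → Point n → Point ∣ I ∣
restrict [] [] = []
restrict (true ∷ I) (b ∷ x) = b ∷ restrict I x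
restrict (false ∷ I) (_ ∷ x) = restrict I x

-- push I w q is the total weight of the points restricting to q on I.
push : (I : Subset n) → (Point n → ℕ) → Point ∣ I ∣ → ℕ
push [] w q = w q
push (true ∷ I) w (b ∷ q) = push I (λ x → w (b ∷ x)) q
push (false ∷ I) w q = push I (λ x → w (true ∷ x) + w (false ∷ x)) q

push-+ : (I : Subset n) (u v : Point n → ℕ) → ∀ q →
         push I (λ x → u x + v x) q ≡ push I u q + push I v q
push-+ [] u v q = refl
push-+ (true ∷ I) u v (b ∷ q) = push-+ I (λ x → u (b ∷ x)) (λ x → v (b ∷ x)) q
push-+ (false ∷ I) u v q = begin
  push I (λ x → (u (true ∷ x) + v (true ∷ x)) + (u (false ∷ x) + v (false ∷ x))) q
    ≡⟨ push-+ I (λ x → u (true ∷ x) + v (true ∷ x)) (λ x → u (false ∷ x) + v (false ∷ x)) q ⟩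
  push I (λ x → u (true ∷ x) + v (true ∷ x)) q + push I (λ x → u (false ∷ x) + v (false ∷ x)) q
    ≡⟨ cong₂ _+_ (push-+ I (u ∘ (true ∷_)) (v ∘ (true ∷_)) q) (push-+ I (u ∘ (false ∷_)) (v ∘ (false ∷_)) q) ⟩
  (push I (u ∘ (true ∷_)) q + push I (v ∘ (true ∷_)) q) + (push I (u ∘ (false ∷_)) q + push I (v ∘ (false ∷_)) q)
    ≡⟨ interchange (push I (u ∘ (true ∷_)) q) _ _ _ ⟩
  (push I (u ∘ (true ∷_)) q + push I (u ∘ (false ∷_)) q) + (push I (v ∘ (true ∷_)) q + push I (v ∘ (false ∷_)) q)
    ≡⟨ cong₂ _+_ (push-+ I (u ∘ (true ∷_)) (u ∘ (false ∷_)) q) (push-+ I (v ∘ (true ∷_)) (v ∘ (false ∷_)) q) ⟨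
  push (false ∷ I) u q + push (false ∷ I) v q ∎
  where open ≡-Reasoning

-- Summation fibre by fibre: `g` is constant on each fibre of the restriction to `I`.
Σₚ-push : (I : Subset n) (w : Point n → ℕ) (g : Point ∣ I ∣ → ℕ) →
          Σₚ n (λ x → w x * g (restrict I x)) ≡ Σₚ ∣ I ∣ (λ q → push I w q * g q)
Σₚ-push [] w g = refl
Σₚ-push (true ∷ I) w g = cong₂ _+_ (Σₚ-push I _ (λ q → g (true ∷ q))) (Σₚ-push I _ (λ q → g (false ∷ q)))
Σₚ-push {suc n} (false ∷ I) w g = begin
  Σₚ n (λ x → w (true ∷ x) * g (restrict I x)) + Σₚ n (λ x → w (false ∷ x) * g (restrict I x))
    ≡⟨ Σₚ-+ n _ _ ⟨
  Σₚ n (λ x → w (true ∷ x) * g (restrict I x) + w (false ∷ x) * g (restrict I x))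
    ≡⟨ Σₚ-cong n (λ x → *-distribʳ-+ (g (restrict I x)) (w (true ∷ x)) (w (false ∷ x))) ⟨
  Σₚ n (λ x → (w (true ∷ x) + w (false ∷ x)) * g (restrict I x))
    ≡⟨ Σₚ-push I _ g ⟩
  Σₚ ∣ I ∣ (λ q → push (false ∷ I) w q * g q) ∎
  where open ≡-Reasoning

Σₚ-push₁ : (I : Subset n) (w : Point n → ℕ) → Σₚ n w ≡ Σₚ ∣ I ∣ (push I w)
Σₚ-push₁ {n} I w = trans (Σₚ-cong n λ x → sym (*-identityʳ (w x)))
  (trans (Σₚ-push I w (λ _ → 1)) (Σₚ-cong ∣ I ∣ λ q → *-identityʳ (push I w q)))

push-supp : (I : Subset n) (w : Point n → ℕ) (q : Point ∣ I ∣) → 0 < push I w q →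
            ∃ λ x → 0 < w x × restrict I x ≡ q
push-supp [] w [] pos = [] , pos , refl
push-supp (true ∷ I) w (b ∷ q) pos =
  let x , wx , eq = push-supp I _ q pos in b ∷ x , wx , cong (b ∷_) eq
push-supp (false ∷ I) w q pos with push-supp I _ q pos
... | x , wx , eq with w (true ∷ x) in wt
...   | suc _ = true ∷ x , subst (0 <_) (sym wt) z<s , eq
...   | zero = false ∷ x , wx , eq

embed : (I : Subset n) → Subset ∣ I ∣ → Subset n
embed [] Y = []
embed (true ∷ I) (y ∷ Y) = y ∷ embed I Y
embed (false ∷ I) Y = false ∷ embed I Y

∣embed∣ : (I : Subset n) (Y : Subset ∣ I ∣) → ∣ embed I Y ∣ ≡ ∣ Y ∣
∣embed∣ [] [] = refl
∣embed∣ (true ∷ I) (true ∷ Y) = cong suc (∣embed∣ I Y)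
∣embed∣ (true ∷ I) (false ∷ Y) = ∣embed∣ I Y
∣embed∣ (false ∷ I) Y = ∣embed∣ I Y

agree-embed : (I : Subset n) (Y : Subset ∣ I ∣) (x p : Point n) →
              Agree Y (restrict I x) (restrict I p) → Agree (embed I Y) x p
agree-embed [] [] [] [] ag = tt
agree-embed (true ∷ I) (true ∷ Y) (_ ∷ x) (_ ∷ p) (eq , ag) = eq , agree-embed I Y x p ag
agree-embed (true ∷ I) (false ∷ Y) (_ ∷ x) (_ ∷ p) ag = agree-embed I Y x p ag
agree-embed (false ∷ I) Y (_ ∷ x) (_ ∷ p) ag = agree-embed I Y x p ag

-- A set shattered by the projection is shattered by the class itself, since every point of the
-- projected support lifts to a point of the support.
VC≤-push : ∀ {d} (I : Subset n) (w : Point n → ℕ) → VC≤ d (Supp w) → VC≤ d (Supp (push I w))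
VC≤-push {d = d} I w vc Y sh = subst (_≤ d) (∣embed∣ I Y) (vc (embed I Y) λ p →
  let q , pos , ag = sh (restrict I p)
      x , wx , eq = push-supp I w q pos
  in x , wx , agree-embed I Y x p (subst (λ r → Agree Y r (restrict I p)) (sym eq) ag))

across : (I : Subset n) (u v : Point n → ℕ) → ℕ
across I u v = Σₚ ∣ I ∣ (λ q → push I u q ⊓ push I v q)

-- The total weight, over i ∉ I, of the edges in direction i of the projection to I ∪ {i}.
outer : (I : Subset n) → (Point n → ℕ) → ℕ
outer [] w = 0
outer (true ∷ I) w = outer I (λ x → w (true ∷ x)) + outer I (λ x → w (false ∷ x))
outer (false ∷ I) w = outer I (λ x → w (true ∷ x) + w (false ∷ x))
                    + across I (λ x → w (true ∷ x)) (λ x → w (false ∷ x))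

-- Random sets of coordinates

module Sampling (a b : ℕ) where

  -- The product measure choosing each coordinate with probability a / (a + b), left unnormalised
  -- with total mass (a + b)ⁿ so that all weights are natural numbers.
  μ : Subset n → ℕ
  μ [] = 1
  μ (true ∷ I) = a * μ I
  μ (false ∷ I) = b * μ I

  𝔼 : ∀ n → (Subset n → ℕ) → ℕ
  𝔼 n f = Σₚ n (λ I → μ I * f I)

  𝔼-suc : ∀ n f → 𝔼 (suc n) f ≡ a * 𝔼 n (λ I → f (true ∷ I)) + b * 𝔼 n (λ I → f (false ∷ I))
  𝔼-suc n f = cong₂ _+_
    (trans (Σₚ-cong n λ I → *-assoc a (μ I) _) (Σₚ-* n a _))
    (trans (Σₚ-cong n λ I → *-assoc b (μ I) _) (Σₚ-* n b _))

  𝔼-+ : ∀ n f g → 𝔼 n (λ I → f I + g I) ≡ 𝔼 n f + 𝔼 n g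
  𝔼-+ n f g = trans (Σₚ-cong n λ I → *-distribˡ-+ (μ I) (f I) (g I)) (Σₚ-+ n _ _)

  𝔼-* : ∀ n k f → 𝔼 n (λ I → k * f I) ≡ k * 𝔼 n f
  𝔼-* n k f = trans (Σₚ-cong n λ I → swap (μ I) k (f I)) (Σₚ-* n k _)
    where
    swap : ∀ x y z → x * (y * z) ≡ y * (x * z)
    swap = solve-∀

  𝔼-mono : ∀ n {f g} → (∀ I → f I ≤ g I) → 𝔼 n f ≤ 𝔼 n g
  𝔼-mono n f≤g = Σₚ-mono n λ I → *-monoʳ-≤ (μ I) (f≤g I)

  𝔼-const : ∀ n k → 𝔼 n (λ _ → k) ≡ (a + b) ^ n * k
  𝔼-const zero k = refl
  𝔼-const (suc n) k = begin
    𝔼 (suc n) (λ _ → k)                              ≡⟨ 𝔼-suc n (λ _ → k) ⟩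
    a * 𝔼 n (λ _ → k) + b * 𝔼 n (λ _ → k)           ≡⟨ *-distribʳ-+ (𝔼 n (λ _ → k)) a b ⟨
    (a + b) * 𝔼 n (λ _ → k)                          ≡⟨ cong ((a + b) *_) (𝔼-const n k) ⟩
    (a + b) * ((a + b) ^ n * k)                      ≡⟨ *-assoc (a + b) ((a + b) ^ n) k ⟨
    (a + b) ^ suc n * k                              ∎
    where open ≡-Reasoning

  -- Adding i to I multiplies μ I by a / b.
  edges-outer : ∀ n (w : Point n → ℕ) →
    b * 𝔼 n (λ I → edges ∣ I ∣ (push I w)) ≡ a * 𝔼 n (λ I → outer I w)
  edges-outer zero w = trans (*-zeroʳ b) (sym (*-zeroʳ a))
  edges-outer (suc n) w = begin
    b * 𝔼 (suc n) (λ I → edges ∣ I ∣ (push I w))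
      ≡⟨ cong (b *_) (𝔼-suc n (λ I → edges ∣ I ∣ (push I w))) ⟩
    b * (a * 𝔼 n (λ I → e I u + e I v + across I u v) + b * 𝔼 n (λ I → e I s))
      ≡⟨ cong (λ z → b * (a * z + b * 𝔼 n (λ I → e I s))) (trans (𝔼-+ n _ _) (cong (_+ X) (𝔼-+ n _ _))) ⟩
    b * (a * (𝔼 n (λ I → e I u) + 𝔼 n (λ I → e I v) + X) + b * 𝔼 n (λ I → e I s))
      ≡⟨ expand a b (𝔼 n (λ I → e I u)) (𝔼 n (λ I → e I v)) X _ ⟩
    a * (b * 𝔼 n (λ I → e I u) + b * 𝔼 n (λ I → e I v) + b * X) + b * (b * 𝔼 n (λ I → e I s))
      ≡⟨ cong₂ _+_ (cong₂ (λ y z → a * (y + z + b * X)) (edges-outer n u) (edges-outer n v))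
                   (cong (b *_) (edges-outer n s)) ⟩
    a * (a * 𝔼 n (λ I → outer I u) + a * 𝔼 n (λ I → outer I v) + b * X) + b * (a * 𝔼 n (λ I → outer I s))
      ≡⟨ collect a b (𝔼 n (λ I → outer I u)) (𝔼 n (λ I → outer I v)) X _ ⟩
    a * (a * (𝔼 n (λ I → outer I u) + 𝔼 n (λ I → outer I v)) + b * (𝔼 n (λ I → outer I s) + X))
      ≡⟨ cong (a *_) (cong₂ _+_ (cong (a *_) (𝔼-+ n _ _)) (cong (b *_) (𝔼-+ n _ _))) ⟨
    a * (a * 𝔼 n (λ I → outer I u + outer I v) + b * 𝔼 n (λ I → outer I s + across I u v))
      ≡⟨ cong (a *_) (𝔼-suc n (λ I → outer I w)) ⟨
    a * 𝔼 (suc n) (λ I → outer I w) ∎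
    where
    open ≡-Reasoning
    u v s : Point n → ℕ
    u x = w (true ∷ x)
    v x = w (false ∷ x)
    s x = u x + v x
    X = 𝔼 n (λ I → across I u v)
    e : Subset n → (Point n → ℕ) → ℕ
    e I f = edges ∣ I ∣ (push I f)
    expand : ∀ a b x y z t → b * (a * (x + y + z) + b * t) ≡ a * (b * x + b * y + b * z) + b * (b * t)
    expand = solve-∀
    collect : ∀ a b x y z t → a * (a * x + a * y + b * z) + b * (a * t) ≡ a * (a * (x + y) + b * (t + z))
    collect = solve-∀

  𝔼sauer : ℕ → ℕ → ℕ
  𝔼sauer n d = 𝔼 n (λ I → sauer ∣ I ∣ d)

  -- Since the expectation of C(∣I∣, i) is C(n, i) pⁱ with p = a / (a + b).
  𝔼sauer-bound : ∀ k N n d → k ≤ N →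
    𝔼sauer n d * (k ^ d * N ^ n) ≤ N ^ d * ((a + b) * N + a * k) ^ n
  𝔼sauer-bound k N zero d k≤N = begin
    1 * (k ^ d * 1)  ≡⟨ trans (*-identityˡ _) (*-identityʳ _) ⟩
    k ^ d            ≤⟨ ^-monoˡ-≤ d k≤N ⟩
    N ^ d            ≡⟨ *-identityʳ _ ⟨
    N ^ d * 1        ∎
    where open ≤-Reasoning
  𝔼sauer-bound k N (suc n) zero k≤N = begin
    𝔼 (suc n) (λ I → sauer ∣ I ∣ 0) * (1 * N ^ suc n)
      ≡⟨ cong (_* (1 * N ^ suc n)) (𝔼-suc n (λ I → sauer ∣ I ∣ 0)) ⟩
    (a * W + b * W) * (1 * (N * N ^ n))
      ≡⟨ regroup a b W N (N ^ n) ⟩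
    (a + b) * N * (W * (1 * N ^ n))
      ≤⟨ *-mono-≤ (m≤m+n ((a + b) * N) (a * k)) (𝔼sauer-bound k N n zero k≤N) ⟩
    R * (1 * R ^ n)
      ≡⟨ swap R 1 (R ^ n) ⟩
    1 * R ^ suc n ∎
    where
    open ≤-Reasoning
    W = 𝔼sauer n 0
    R = (a + b) * N + a * k
    regroup : ∀ a b w N M → (a * w + b * w) * (1 * (N * M)) ≡ (a + b) * N * (w * (1 * M))
    regroup = solve-∀
    swap : ∀ x y z → x * (y * z) ≡ y * (x * z)
    swap = solve-∀
  -- After normalisation the bound is (N / k)ᵈ (1 + p k / N)ⁿ; the two terms of Pascal's rule supply
  -- the summands 1 and p k / N of one more factor.
  𝔼sauer-bound k N (suc n) (suc d) k≤N = begin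
    𝔼 (suc n) (λ I → sauer ∣ I ∣ (suc d)) * (k ^ suc d * N ^ suc n)
      ≡⟨ cong (_* (k ^ suc d * N ^ suc n)) (trans (𝔼-suc n (λ I → sauer ∣ I ∣ (suc d))) (cong (λ z → a * z + b * W₁) (𝔼-+ n (λ I → sauer ∣ I ∣ (suc d)) (λ I → sauer ∣ I ∣ d)))) ⟩
    (a * (W₁ + W₀) + b * W₁) * (k * k ^ d * (N * N ^ n))
      ≡⟨ regroup a b W₁ W₀ k (k ^ d) N (N ^ n) ⟩
    (a + b) * N * (W₁ * (k ^ suc d * N ^ n)) + a * k * N * (W₀ * (k ^ d * N ^ n))
      ≤⟨ +-mono-≤ (*-monoʳ-≤ ((a + b) * N) (𝔼sauer-bound k N n (suc d) k≤N))
                  (*-monoʳ-≤ (a * k * N) (𝔼sauer-bound k N n d k≤N)) ⟩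
    (a + b) * N * (N * N ^ d * R ^ n) + a * k * N * (N ^ d * R ^ n)
      ≡⟨ collect (a + b) (a * k) N (N ^ d) (R ^ n) ⟩
    N ^ suc d * R ^ suc n ∎
    where
    open ≤-Reasoning
    W₁ = 𝔼sauer n (suc d)
    W₀ = 𝔼sauer n d
    R = (a + b) * N + a * k
    regroup : ∀ a b w v k K N M → (a * (w + v) + b * w) * (k * K * (N * M)) ≡
              (a + b) * N * (w * (k * K * M)) + a * k * N * (v * (K * M))
    regroup = solve-∀
    collect : ∀ c e N D t → c * N * (N * D * t) + e * N * (D * t) ≡ N * D * ((c * N + e) * t)
    collect = solve-∀

-- Hamming distance

_≟ᵖ_ : (x y : Point n) → Dec (x ≡ y)
_≟ᵖ_ = ≡-dec _≟ᵇ_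

δ : Bool → Bool → ℕ
δ true true = 0
δ true false = 1
δ false true = 1
δ false false = 0

dist : Point n → Point n → ℕ
dist [] [] = 0
dist (a ∷ x) (b ∷ y) = δ a b + dist x y

distOff : Subset n → Point n → Point n → ℕ
distOff [] [] [] = 0
distOff (true ∷ I) (_ ∷ x) (_ ∷ y) = distOff I x y
distOff (false ∷ I) (a ∷ x) (b ∷ y) = δ a b + distOff I x y

δ-refl : ∀ a → δ a a ≡ 0
δ-refl true = refl
δ-refl false = refl

δ-triangle : ∀ a b c → δ a b ≤ δ a c + δ b c
δ-triangle true true c = z≤n
δ-triangle true false true = ≤-refl
δ-triangle true false false = ≤-refl
δ-triangle false true true = ≤-refl
δ-triangle false true false = ≤-refl
δ-triangle false false c = z≤n

-- Points of one fibre differ only outside `I`, and there the triangle inequality passes through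
-- `z`.
dist≤distOff : (I : Subset n) (x y z : Point n) → restrict I x ≡ restrict I y →
               dist x y ≤ distOff I x z + distOff I y z
dist≤distOff [] [] [] [] eq = z≤n
dist≤distOff (true ∷ I) (a ∷ x) (b ∷ y) (_ ∷ z) eq with refl , eq′ ← ∷-injective eq =
  subst (λ t → t + dist x y ≤ _) (sym (δ-refl a)) (dist≤distOff I x y z eq′)
dist≤distOff (false ∷ I) (a ∷ x) (b ∷ y) (c ∷ z) eq = ≤-trans
  (+-mono-≤ (δ-triangle a b c) (dist≤distOff I x y z eq))
  (≤-reflexive (interchange (δ a c) (δ b c) _ _))

-- The packing lemma

-- The centre of a fibre takes in each coordinate outside I the majority value of the fibre.
centres : (I : Subset n) (w : Point n → ℕ) → ∃ λ (m : Point ∣ I ∣ → Point n) →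
          Σₚ n (λ x → w x * distOff I x (m (restrict I x))) ≤ outer I w
centres [] w = id , ≤-reflexive (*-zeroʳ (w []))
centres (true ∷ I) w with m₁ , h₁ ← centres I (λ x → w (true ∷ x)) | m₀ , h₀ ← centres I (λ x → w (false ∷ x)) =
  (λ { (true ∷ q) → true ∷ m₁ q ; (false ∷ q) → false ∷ m₀ q }) , +-mono-≤ h₁ h₀
centres {suc n} (false ∷ I) w with m , h ← centres I (λ x → w (true ∷ x) + w (false ∷ x)) =
  (λ q → maj q ∷ m q) , (begin
    Σₚ n (λ x → u x * (δ true (maj (r x)) + D x)) + Σₚ n (λ x → v x * (δ false (maj (r x)) + D x))
      ≡⟨ trans (sym (Σₚ-+ n _ _)) (Σₚ-cong n λ x → rearrange (u x) (v x) _ _ (D x)) ⟩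
    Σₚ n (λ x → (u x + v x) * D x + (u x * δ true (maj (r x)) + v x * δ false (maj (r x))))
      ≡⟨ trans (Σₚ-+ n _ _) (cong (Σₚ n (λ x → (u x + v x) * D x) +_) (Σₚ-+ n _ _)) ⟩
    Σₚ n (λ x → (u x + v x) * D x) + (Σₚ n (λ x → u x * δ true (maj (r x))) + Σₚ n (λ x → v x * δ false (maj (r x))))
      ≡⟨ cong (Σₚ n (λ x → (u x + v x) * D x) +_) (trans (cong₂ _+_ (Σₚ-push I u (λ q → δ true (maj q))) (Σₚ-push I v (λ q → δ false (maj q)))) (sym (Σₚ-+ ∣ I ∣ _ _))) ⟩
    Σₚ n (λ x → (u x + v x) * D x) + Σₚ ∣ I ∣ (λ q → push I u q * δ true (maj q) + push I v q * δ false (maj q))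
      ≤⟨ +-mono-≤ h (Σₚ-mono ∣ I ∣ λ q → minority (push I u q) (push I v q)) ⟩
    outer (false ∷ I) w ∎)
  where
  open ≤-Reasoning
  u v : Point n → ℕ
  u x = w (true ∷ x)
  v x = w (false ∷ x)
  r = restrict I
  maj : Point ∣ I ∣ → Bool
  maj q = push I v q ≤ᵇ push I u q
  D : Point n → ℕ
  D x = distOff I x (m (r x))
  rearrange : ∀ a b s t d → a * (s + d) + b * (t + d) ≡ (a + b) * d + (a * s + b * t)
  rearrange = solve-∀
  -- The majority value is wrong exactly on the lighter side, whose weight is the weight of the
  -- edge.
  minority : ∀ a b → a * δ true (b ≤ᵇ a) + b * δ false (b ≤ᵇ a) ≤ a ⊓ b
  minority a b with b ≤ᵇ a in eq
  ... | true = ≤-reflexive (trans (cong₂ _+_ (*-zeroʳ a) (*-identityʳ b))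
                 (sym (m≥n⇒m⊓n≡n (≤ᵇ⇒≤ b a (subst T (sym eq) tt)))))
  ... | false = ≤-reflexive (trans (cong₂ _+_ (*-identityʳ a) (*-zeroʳ b)) (trans (+-identityʳ a)
                  (sym (m≤n⇒m⊓n≡m (≰⇒≥ λ b≤a → subst T eq (≤⇒≤ᵇ b≤a))))))

push-mono : (I : Subset n) {f g : Point n → ℕ} → ∀ q → (∀ x → restrict I x ≡ q → f x ≤ g x) →
            push I f q ≤ push I g q
push-mono [] [] f≤g = f≤g [] refl
push-mono (true ∷ I) (b ∷ q) f≤g = push-mono I q λ x eq → f≤g (b ∷ x) (cong (b ∷_) eq)
push-mono (false ∷ I) q f≤g = push-mono I q λ x eq → +-mono-≤ (f≤g (true ∷ x) eq) (f≤g (false ∷ x) eq)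

push-* : (I : Subset n) (k : ℕ) (f : Point n → ℕ) → ∀ q → push I (λ x → k * f x) q ≡ k * push I f q
push-* [] k f q = refl
push-* (true ∷ I) k f (b ∷ q) = push-* I k (λ x → f (b ∷ x)) q
push-* (false ∷ I) k f q = trans (push-+ I (λ x → k * f (true ∷ x)) (λ x → k * f (false ∷ x)) q)
  (trans (cong₂ _+_ (push-* I k (f ∘ (true ∷_)) q) (push-* I k (f ∘ (false ∷_)) q))
  (trans (sym (*-distribˡ-+ k (push I (f ∘ (true ∷_)) q) _))
         (cong (k *_) (sym (push-+ I (f ∘ (true ∷_)) (f ∘ (false ∷_)) q)))))

all-or-counterexample : ∀ n {P : Point n → Set} → (∀ x → Dec (P x)) → (∀ x → P x) ⊎ ∃ λ x → ¬ P x
all-or-counterexample zero P? with P? []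
... | yes p = inj₁ λ { [] → p }
... | no ¬p = inj₂ ([] , ¬p)
all-or-counterexample (suc n) P? with all-or-counterexample n (P? ∘ (true ∷_)) | all-or-counterexample n (P? ∘ (false ∷_))
... | inj₂ (x , ¬p) | _ = inj₂ (true ∷ x , ¬p)
... | inj₁ _ | inj₂ (x , ¬p) = inj₂ (false ∷ x , ¬p)
... | inj₁ h₁ | inj₁ h₀ = inj₁ λ { (true ∷ x) → h₁ x ; (false ∷ x) → h₀ x }

module _ (k : ℕ) where

  -- `D` is meant as the distance to the centre, and the factor 2 encodes the radius k / 2. Points
  -- off the fibre or of weight 0 count as far.
  Far : (I : Subset n) → Point ∣ I ∣ → (w D : Point n → ℕ) → Point n → Set
  Far I q w D x = restrict I x ≡ q → 0 < w x → k ≤ 2 * D x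

  far? : (I : Subset n) → ∀ q w D x → Dec (Far I q w D x)
  far? I q w D x = (restrict I x ≟ᵖ q) →-dec ((0 <? w x) →-dec (k ≤? 2 * D x))

  far-fibre : (I : Subset n) (q : Point ∣ I ∣) (w D : Point n → ℕ) → (∀ x → Far I q w D x) →
              k * push I w q ≤ 2 * push I (λ x → w x * D x) q
  far-fibre I q w D far = subst₂ _≤_ (push-* I k w q) (push-* I 2 (λ x → w x * D x) q)
    (push-mono I q λ x eq → pointwise x (far x eq))
    where
    swap : ∀ a b c → a * (b * c) ≡ b * (a * c)
    swap = solve-∀
    pointwise : ∀ x → (0 < w x → k ≤ 2 * D x) → k * w x ≤ 2 * (w x * D x)
    pointwise x far with w x
    ... | zero = ≤-reflexive (*-zeroʳ k)
    ... | suc m = ≤-trans (≤-reflexive (*-comm k (suc m)))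
                          (≤-trans (*-monoʳ-≤ (suc m) (far z<s)) (≤-reflexive (swap (suc m) 2 (D x))))

  -- At most one point of the fibre is closer than k / 2 to the centre.
  fibre : (I : Subset n) (q : Point ∣ I ∣) (w D : Point n → ℕ) → (∀ x → w x ≤ 1) →
          (∀ x y → x ≢ y → restrict I x ≡ q → restrict I y ≡ q → 0 < w x → 0 < w y → k ≤ D x + D y) →
          k * push I w q ≤ 2 * push I (λ x → w x * D x) q + k
  fibre [] [] w D w≤1 sep = ≤-trans (*-monoʳ-≤ k (w≤1 [])) (≤-trans (≤-reflexive (*-identityʳ k)) (m≤n+m k _))
  fibre (true ∷ I) (b ∷ q) w D w≤1 sep = fibre I q _ _ (w≤1 ∘ (b ∷_)) λ x y x≢y ex ey →
    sep (b ∷ x) (b ∷ y) (x≢y ∘ ∷-injectiveʳ) (cong (b ∷_) ex) (cong (b ∷_) ey)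
  fibre {suc n} (false ∷ I) q w D w≤1 sep = begin
    k * push I (λ x → u x + v x) q
      ≡⟨ trans (cong (k *_) (push-+ I u v q)) (*-distribˡ-+ k (push I u q) _) ⟩
    k * push I u q + k * push I v q
      ≤⟨ halves ⟩
    2 * push I (λ x → u x * Du x) q + 2 * push I (λ x → v x * Dv x) q + k
      ≡⟨ cong (_+ k) (trans (cong (2 *_) (push-+ I (λ x → u x * Du x) (λ x → v x * Dv x) q)) (*-distribˡ-+ 2 (push I (λ x → u x * Du x) q) _)) ⟨
    2 * push I (λ x → u x * Du x + v x * Dv x) q + k ∎
    where
    open ≤-Reasoning
    u v Du Dv : Point n → ℕ
    u x = w (true ∷ x)
    v x = w (false ∷ x)
    Du x = D (true ∷ x)
    Dv x = D (false ∷ x)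
    fibreᵤ = fibre I q u Du (w≤1 ∘ (true ∷_)) λ x y x≢y → sep (true ∷ x) (true ∷ y) (x≢y ∘ ∷-injectiveʳ)
    fibreᵥ = fibre I q v Dv (w≤1 ∘ (false ∷_)) λ x y x≢y → sep (false ∷ x) (false ∷ y) (x≢y ∘ ∷-injectiveʳ)
    opposite : ∀ s t → k ≤ s + t → ¬ k ≤ 2 * s → k ≤ 2 * t
    opposite s t k≤ ¬k≤ = +-cancelˡ-≤ k k (2 * t) (begin
      k + k              ≤⟨ +-mono-≤ k≤ k≤ ⟩
      (s + t) + (s + t)  ≡⟨ double s t ⟩
      2 * s + 2 * t      ≤⟨ +-monoˡ-≤ (2 * t) (≰⇒≥ ¬k≤) ⟩
      k + 2 * t          ∎)
      where
      double : ∀ s t → (s + t) + (s + t) ≡ 2 * s + 2 * t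
      double = solve-∀
    halves : k * push I u q + k * push I v q ≤
             2 * push I (λ x → u x * Du x) q + 2 * push I (λ x → v x * Dv x) q + k
    -- Two points nearer than k / 2 to the centre would violate the separation. So one half is
    -- entirely far, and only the other half uses the extra `k`.
    halves with all-or-counterexample n (far? I q u Du)
    ... | inj₁ far = ≤-trans (+-mono-≤ (far-fibre I q u Du far) fibreᵥ)
                             (≤-reflexive (sym (+-assoc (2 * push I (λ x → u x * Du x) q) _ k)))
    ... | inj₂ (x , near) = ≤-trans (+-mono-≤ fibreᵤ (far-fibre I q v Dv far))
                                    (≤-reflexive (slide (2 * push I (λ x → u x * Du x) q) k _))
      where
      slide : ∀ s k t → s + k + t ≡ s + t + k
      slide = solve-∀
      far : ∀ y → Far I q v Dv y
      far y ey vy with restrict I x ≟ᵖ q | 0 <? u x | k ≤? 2 * Du x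
      ... | no ¬ex | _ | _ = ⊥-elim (near λ ex → ⊥-elim (¬ex ex))
      ... | yes _ | no ¬ux | _ = ⊥-elim (near λ _ ux → ⊥-elim (¬ux ux))
      ... | yes _ | yes _ | yes k≤ = ⊥-elim (near λ _ _ → k≤)
      ... | yes ex | yes ux | no ¬k≤ =
        opposite (Du x) (Dv y) (sep (true ∷ x) (false ∷ y) (λ ()) ex ey ux vy) ¬k≤

  Separated : (Point n → ℕ) → Set
  Separated w = ∀ x y → x ≢ y → 0 < w x → 0 < w y → k ≤ dist x y

  -- Summed over all fibres, `fibre` charges all weight beyond one point per fibre to distances from
  -- the centres, and `centres` bounds these by `outer`.
  separated-outer : (I : Subset n) (w : Point n → ℕ) → (∀ x → w x ≤ 1) → Separated w →
                    k * Σₚ n w ≤ 2 * outer I w + k * ∣supp∣ ∣ I ∣ (push I w)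
  separated-outer {n} I w w≤1 sep with m , h ← centres I w = begin
    k * Σₚ n w
      ≡⟨ trans (cong (k *_) (Σₚ-push₁ I w)) (sym (Σₚ-* ℓ k _)) ⟩
    Σₚ ℓ (λ q → k * push I w q)
      ≤⟨ Σₚ-mono ℓ perFibre ⟩
    Σₚ ℓ (λ q → 2 * push I wD q + k * (1 ⊓ push I w q))
      ≡⟨ trans (Σₚ-+ ℓ _ _) (cong₂ _+_ (Σₚ-* ℓ 2 _) (Σₚ-* ℓ k _)) ⟩
    2 * Σₚ ℓ (push I wD) + k * ∣supp∣ ℓ (push I w)
      ≡⟨ cong (λ s → 2 * s + k * ∣supp∣ ℓ (push I w)) (Σₚ-push₁ I wD) ⟨
    2 * Σₚ n wD + k * ∣supp∣ ℓ (push I w)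
      ≤⟨ +-monoˡ-≤ _ (*-monoʳ-≤ 2 h) ⟩
    2 * outer I w + k * ∣supp∣ ℓ (push I w) ∎
    where
    open ≤-Reasoning
    ℓ = ∣ I ∣
    D wD : Point n → ℕ
    D x = distOff I x (m (restrict I x))
    wD x = w x * D x
    apart : ∀ q x y → x ≢ y → restrict I x ≡ q → restrict I y ≡ q → 0 < w x → 0 < w y → k ≤ D x + D y
    apart q x y x≢y ex ey wx wy = ≤-trans (sep x y x≢y wx wy)
      (≤-trans (dist≤distOff I x y (m q) (trans ex (sym ey)))
               (≤-reflexive (cong₂ (λ s t → distOff I x (m s) + distOff I y (m t)) (sym ex) (sym ey))))
    -- An empty fibre needs no extra `k`; hence only the support of the projection is counted.
    perFibre : ∀ q → k * push I w q ≤ 2 * push I wD q + k * (1 ⊓ push I w q)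
    perFibre q with push I w q | fibre I q w D w≤1 (apart q)
    ... | zero | _ = ≤-trans (≤-reflexive (*-zeroʳ k)) z≤n
    ... | suc _ | h = ≤-trans h (≤-reflexive (cong (2 * push I wD q +_) (sym (*-identityʳ k))))

module _ (d k : ℕ) .{{_ : NonZero d}} .{{_ : NonZero k}} where
  open Sampling (4 * d) k

  -- The sampling rate 4d / (4d + k) is chosen so that the edge bound accounts for half of the points.
  half-survives : (w : Point n → ℕ) → VC≤ d (Supp w) → (∀ x → w x ≤ 1) → Separated k w →
                  (4 * d + k) ^ n * Σₚ n w ≤ 2 * 𝔼sauer n d
  half-survives {n} w vc w≤1 sep = +-cancelˡ-≤ (Z * S) _ _ (*-cancelˡ-≤ (2 * d * k) {{nz}} (begin
    2 * d * k * (Z * S + Z * S)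
      ≡⟨ e₁ d k Z S ⟩
    4 * d * (Z * (k * S))
      ≤⟨ *-monoʳ-≤ (4 * d) sampled ⟩
    4 * d * (2 * O + k * W)
      ≡⟨ e₂ d k O W ⟩
    2 * (4 * d * O) + 4 * d * k * W
      ≡⟨ cong (λ t → 2 * t + 4 * d * k * W) (edges-outer n w) ⟨
    -- The edge bound makes the first term at most 2dk · ZS, half of the initial 4dk · ZS; this half
    -- is then cancelled.
    2 * (k * 𝔼 n (λ I → edges ∣ I ∣ (push I w))) + 4 * d * k * W
      ≤⟨ +-monoˡ-≤ (4 * d * k * W) (*-monoʳ-≤ 2 (*-monoʳ-≤ k edge)) ⟩
    2 * (k * (Z * (d * S))) + 4 * d * k * W
      ≡⟨ e₃ d k Z S W ⟩
    2 * d * k * (Z * S + 2 * W) ∎))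
    where
    open ≤-Reasoning
    Z = (4 * d + k) ^ n
    S = Σₚ n w
    O = 𝔼 n (λ I → outer I w)
    W = 𝔼sauer n d
    nz : NonZero (2 * d * k)
    nz = m*n≢0 (2 * d) k {{m*n≢0 2 d}}
    e₁ : ∀ d k Z S → 2 * d * k * (Z * S + Z * S) ≡ 4 * d * (Z * (k * S))
    e₁ = solve-∀
    e₂ : ∀ d k O W → 4 * d * (2 * O + k * W) ≡ 2 * (4 * d * O) + 4 * d * k * W
    e₂ = solve-∀
    e₃ : ∀ d k Z S W → 2 * (k * (Z * (d * S))) + 4 * d * k * W ≡ 2 * d * k * (Z * S + 2 * W)
    e₃ = solve-∀
    sampled : Z * (k * S) ≤ 2 * O + k * W
    sampled = begin
      Z * (k * S)                                                     ≡⟨ 𝔼-const n (k * S) ⟨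
      𝔼 n (λ _ → k * S)                                               ≤⟨ 𝔼-mono n (λ I → separated-outer k I w w≤1 sep) ⟩
      𝔼 n (λ I → 2 * outer I w + k * ∣supp∣ ∣ I ∣ (push I w))
        ≡⟨ trans (𝔼-+ n (λ I → 2 * outer I w) (λ I → k * ∣supp∣ ∣ I ∣ (push I w))) (cong₂ _+_ (𝔼-* n 2 (λ I → outer I w)) (𝔼-* n k (λ I → ∣supp∣ ∣ I ∣ (push I w)))) ⟩
      2 * O + k * 𝔼 n (λ I → ∣supp∣ ∣ I ∣ (push I w))
        ≤⟨ +-monoʳ-≤ (2 * O) (*-monoʳ-≤ k (𝔼-mono n λ I → ∣supp∣≤sauer ∣ I ∣ d (push I w) (VC≤-push I w vc))) ⟩
      2 * O + k * W ∎
    edge : 𝔼 n (λ I → edges ∣ I ∣ (push I w)) ≤ Z * (d * S)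
    edge = begin
      𝔼 n (λ I → edges ∣ I ∣ (push I w))
        ≤⟨ 𝔼-mono n (λ I → ≤-trans (edges-bound ∣ I ∣ d (push I w) (VC≤-push I w vc)) (≤-reflexive (cong (d *_) (sym (Σₚ-push₁ I w))))) ⟩
      𝔼 n (λ _ → d * S)
        ≡⟨ 𝔼-const n (d * S) ⟩
      Z * (d * S) ∎

-- Bernoulli's inequality for (1 − 1/(M+1))ʲ.
bernoulli : ∀ M j → suc M ^ j * (suc M ∸ j) ≤ M ^ j * suc M
bernoulli M zero = ≤-refl
bernoulli M (suc j) = begin
  suc M * suc M ^ j * (M ∸ j)         ≡⟨ e₁ (suc M) (suc M ^ j) (M ∸ j) ⟩
  suc M ^ j * (suc M * (M ∸ j))       ≤⟨ *-monoʳ-≤ (suc M ^ j) step ⟩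
  suc M ^ j * (M * (suc M ∸ j))       ≡⟨ e₁ M (suc M ^ j) (suc M ∸ j) ⟨
  M * suc M ^ j * (suc M ∸ j)         ≡⟨ *-assoc M (suc M ^ j) _ ⟩
  M * (suc M ^ j * (suc M ∸ j))       ≤⟨ *-monoʳ-≤ M (bernoulli M j) ⟩
  M * (M ^ j * suc M)                 ≡⟨ *-assoc M (M ^ j) (suc M) ⟨
  M * M ^ j * suc M                   ∎
  where
  open ≤-Reasoning
  e₁ : ∀ a b c → a * b * c ≡ b * (a * c)
  e₁ = solve-∀
  step : suc M * (M ∸ j) ≤ M * (suc M ∸ j)
  step with j ≤? M
  ... | yes j≤M = begin
    (M ∸ j) + M * (M ∸ j)  ≤⟨ +-monoˡ-≤ (M * (M ∸ j)) (m∸n≤m M j) ⟩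
    M + M * (M ∸ j)        ≡⟨ *-suc M (M ∸ j) ⟨
    M * suc (M ∸ j)        ≡⟨ cong (M *_) (+-∸-assoc 1 j≤M) ⟨
    M * (suc M ∸ j)        ∎
  ... | no j≰M = begin
    suc M * (M ∸ j)        ≡⟨ cong (suc M *_) (m≤n⇒m∸n≡0 (≰⇒≥ j≰M)) ⟩
    suc M * 0              ≡⟨ *-zeroʳ (suc M) ⟩
    0                      ≤⟨ z≤n ⟩
    M * (suc M ∸ j)        ∎

-- By Bernoulli, (1 - 1/(M+1))ʲ ≥ 1 - j/(M+1) ≥ 1/2.
pow-step₂ : ∀ M j → 2 * j ≤ suc M → suc M ^ j ≤ 2 * M ^ j
pow-step₂ M j 2j≤ = *-cancelʳ-≤ _ _ (suc M) (begin
  suc M ^ j * suc M                   ≤⟨ *-monoʳ-≤ (suc M ^ j) small ⟩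
  suc M ^ j * (2 * (suc M ∸ j))       ≡⟨ e₁ (suc M ^ j) 2 _ ⟩
  2 * (suc M ^ j * (suc M ∸ j))       ≤⟨ *-monoʳ-≤ 2 (bernoulli M j) ⟩
  2 * (M ^ j * suc M)                 ≡⟨ *-assoc 2 (M ^ j) (suc M) ⟨
  2 * M ^ j * suc M                   ∎)
  where
  open ≤-Reasoning
  e₁ : ∀ a b c → a * (b * c) ≡ b * (a * c)
  e₁ = solve-∀
  small : suc M ≤ 2 * (suc M ∸ j)
  small = begin
    suc M                          ≡⟨ m+n∸n≡m (suc M) (2 * j) ⟨
    suc M + 2 * j ∸ 2 * j          ≤⟨ ∸-monoˡ-≤ (2 * j) (+-monoʳ-≤ (suc M) 2j≤) ⟩
    suc M + suc M ∸ 2 * j          ≡⟨ cong (λ t → suc M + t ∸ 2 * j) (sym (+-identityʳ (suc M))) ⟩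
    2 * suc M ∸ 2 * j              ≡⟨ *-distribˡ-∸ 2 (suc M) j ⟨
    2 * (suc M ∸ j)                ∎

-- Splitting the exponent in two halves brings each within the range of `pow-step₂`.
pow-step₄ : ∀ M N → N ≤ M → suc M ^ N ≤ 4 * M ^ N
pow-step₄ M N N≤M = begin
  suc M ^ N                                ≡⟨ cong (suc M ^_) (⌊n/2⌋+⌈n/2⌉≡n N) ⟨
  suc M ^ (h + h′)                         ≡⟨ ^-distribˡ-+-* (suc M) h h′ ⟩
  suc M ^ h * suc M ^ h′                   ≤⟨ *-mono-≤ (pow-step₂ M h (≤-trans (*-monoʳ-≤ 2 (⌊n/2⌋≤⌈n/2⌉ N)) 2h′≤)) (pow-step₂ M h′ 2h′≤) ⟩
  2 * M ^ h * (2 * M ^ h′)                 ≡⟨ e₁ (M ^ h) (M ^ h′) ⟩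
  4 * (M ^ h * M ^ h′)                     ≡⟨ cong (4 *_) (^-distribˡ-+-* M h h′) ⟨
  4 * M ^ (h + h′)                         ≡⟨ cong (λ t → 4 * M ^ t) (⌊n/2⌋+⌈n/2⌉≡n N) ⟩
  4 * M ^ N                                ∎
  where
  open ≤-Reasoning
  h = ⌊ N /2⌋
  h′ = ⌈ N /2⌉
  e₁ : ∀ a b → 2 * a * (2 * b) ≡ 4 * (a * b)
  e₁ = solve-∀
  2h′≤ : 2 * h′ ≤ suc M
  2h′≤ = begin
    h′ + (h′ + 0)        ≡⟨ cong (h′ +_) (+-identityʳ h′) ⟩
    h′ + h′              ≤⟨ +-monoʳ-≤ h′ (⌊n/2⌋≤⌈n/2⌉ (suc N)) ⟩
    h′ + ⌈ suc N /2⌉     ≡⟨ ⌊n/2⌋+⌈n/2⌉≡n (suc N) ⟩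
    suc N                ≤⟨ s≤s N≤M ⟩
    suc M                ∎

-- An integer substitute for (1 + j / N)^N ≤ eʲ, with 4 in place of e: each unit of shift costs one
-- factor 4.
pow-shift : ∀ N j → (N + j) ^ N ≤ 4 ^ j * N ^ N
pow-shift N zero = ≤-reflexive (trans (cong (_^ N) (+-identityʳ N)) (sym (*-identityˡ _)))
pow-shift N (suc j) = begin
  (N + suc j) ^ N        ≡⟨ cong (_^ N) (+-suc N j) ⟩
  suc (N + j) ^ N        ≤⟨ pow-step₄ (N + j) N (m≤m+n N j) ⟩
  4 * (N + j) ^ N        ≤⟨ *-monoʳ-≤ 4 (pow-shift N j) ⟩
  4 * (4 ^ j * N ^ N)    ≡⟨ *-assoc 4 (4 ^ j) _ ⟨
  4 ^ suc j * N ^ N      ∎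
  where open ≤-Reasoning

^-distribʳ-* : ∀ n a b → (a * b) ^ n ≡ a ^ n * b ^ n
^-distribʳ-* zero a b = refl
^-distribʳ-* (suc n) a b = trans (cong (a * b *_) (^-distribʳ-* n a b)) (shuffle a b (a ^ n) (b ^ n))
  where
  shuffle : ∀ a b x y → a * b * (x * y) ≡ a * x * (b * y)
  shuffle = solve-∀

-- Haussler's bound with an explicit constant. `half-survives` reduces it to the expected
-- Sauer-Shelah sum, whose remaining factor is at most (1 + 4d / N)^N ≤ 4^(4d), because p k ≤ 4d for
-- the sampling rate p.
packing : ∀ N d k .{{_ : NonZero N}} .{{_ : NonZero d}} .{{_ : NonZero k}} → k ≤ N →
          (w : Point N → ℕ) → VC≤ d (Supp w) → (∀ x → w x ≤ 1) → Separated k w →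
          Σₚ N w * k ^ d ≤ 2 * (4 ^ (4 * d) * N ^ d)
packing N d k k≤N w vc w≤1 sep = *-cancelʳ-≤ _ _ (Z * N ^ N) {{nz}} (begin
  S * k ^ d * (Z * N ^ N)
    ≡⟨ e₁ S (k ^ d) Z (N ^ N) ⟩
  Z * S * (k ^ d * N ^ N)
    ≤⟨ *-monoˡ-≤ (k ^ d * N ^ N) (half-survives d k w vc w≤1 sep) ⟩
  2 * W * (k ^ d * N ^ N)
    ≡⟨ *-assoc 2 W _ ⟩
  2 * (W * (k ^ d * N ^ N))
    ≤⟨ *-monoʳ-≤ 2 (𝔼sauer-bound k N N d k≤N) ⟩
  2 * (N ^ d * ((4 * d + k) * N + 4 * d * k) ^ N)
    ≤⟨ *-monoʳ-≤ 2 (*-monoʳ-≤ (N ^ d) (^-monoˡ-≤ N factor)) ⟩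
  2 * (N ^ d * ((4 * d + k) * (N + 4 * d)) ^ N)
    ≡⟨ cong (λ t → 2 * (N ^ d * t)) (^-distribʳ-* N (4 * d + k) (N + 4 * d)) ⟩
  2 * (N ^ d * (Z * (N + 4 * d) ^ N))
    ≤⟨ *-monoʳ-≤ 2 (*-monoʳ-≤ (N ^ d) (*-monoʳ-≤ Z (pow-shift N (4 * d)))) ⟩
  2 * (N ^ d * (Z * (4 ^ (4 * d) * N ^ N)))
    ≡⟨ e₂ (N ^ d) Z (4 ^ (4 * d)) (N ^ N) ⟩
  2 * (4 ^ (4 * d) * N ^ d) * (Z * N ^ N) ∎)
  where
  open ≤-Reasoning
  open Sampling (4 * d) k
  Z = (4 * d + k) ^ N
  S = Σₚ N w
  W = 𝔼sauer N d
  nz : NonZero (Z * N ^ N)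
  nz = m*n≢0 Z (N ^ N) {{m^n≢0 (4 * d + k) N {{>-nonZero (≤-trans (>-nonZero⁻¹ k) (m≤n+m k (4 * d)))}}}} {{m^n≢0 N N}}
  e₁ : ∀ S K Z M → S * K * (Z * M) ≡ Z * S * (K * M)
  e₁ = solve-∀
  e₂ : ∀ D Z F M → 2 * (D * (Z * (F * M))) ≡ 2 * (F * D) * (Z * M)
  e₂ = solve-∀
  e₃ : ∀ d k N → (4 * d + k) * (N + 4 * d) ≡ (4 * d + k) * N + (4 * d * k + 4 * d * (4 * d))
  e₃ = solve-∀
  factor : (4 * d + k) * N + 4 * d * k ≤ (4 * d + k) * (N + 4 * d)
  factor = ≤-trans (+-monoʳ-≤ ((4 * d + k) * N) (m≤m+n (4 * d * k) (4 * d * (4 * d)))) (≤-reflexive (sym (e₃ d k N)))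

-- Walks in the cube

dist-refl : (x : Point n) → dist x x ≡ 0
dist-refl [] = refl
dist-refl (a ∷ x) = cong₂ _+_ (δ-refl a) (dist-refl x)

dist-sym : (x y : Point n) → dist x y ≡ dist y x
dist-sym [] [] = refl
dist-sym (true ∷ x) (true ∷ y) = dist-sym x y
dist-sym (true ∷ x) (false ∷ y) = cong suc (dist-sym x y)
dist-sym (false ∷ x) (true ∷ y) = cong suc (dist-sym x y)
dist-sym (false ∷ x) (false ∷ y) = dist-sym x y

dist≤n : (x y : Point n) → dist x y ≤ n
dist≤n [] [] = z≤n
dist≤n (true ∷ x) (true ∷ y) = m≤n⇒m≤1+n (dist≤n x y)
dist≤n (true ∷ x) (false ∷ y) = s≤s (dist≤n x y)
dist≤n (false ∷ x) (true ∷ y) = s≤s (dist≤n x y)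
dist≤n (false ∷ x) (false ∷ y) = m≤n⇒m≤1+n (dist≤n x y)

dist≡0⇒≡ : (x y : Point n) → dist x y ≡ 0 → x ≡ y
dist≡0⇒≡ [] [] eq = refl
dist≡0⇒≡ (true ∷ x) (true ∷ y) eq = cong (true ∷_) (dist≡0⇒≡ x y eq)
dist≡0⇒≡ (false ∷ x) (false ∷ y) eq = cong (false ∷_) (dist≡0⇒≡ x y eq)

flip : Fin n → Point n → Point n
flip zero (b ∷ x) = not b ∷ x
flip (suc i) (b ∷ x) = b ∷ flip i x

endpoint : Point n → List (Fin n) → Point n
endpoint s [] = s
endpoint s (i ∷ w) = endpoint (flip i s) w

visited : Point n → List (Fin n) → List (Point n)
visited s [] = s ∷ []
visited s (i ∷ w) = s ∷ visited (flip i s) w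

endpoint∈visited : (s : Point n) (w : List (Fin n)) → endpoint s w ∈ visited s w
endpoint∈visited s [] = here refl
endpoint∈visited s (i ∷ w) = there (endpoint∈visited (flip i s) w)

endpoint-++ : (s : Point n) (v w : List (Fin n)) → endpoint s (v ++ w) ≡ endpoint (endpoint s v) w
endpoint-++ s [] w = refl
endpoint-++ s (i ∷ v) w = endpoint-++ (flip i s) v w

visited-++ˡ : (s : Point n) (v w : List (Fin n)) → ∀ {x} → x ∈ visited s v → x ∈ visited s (v ++ w)
visited-++ˡ s [] [] (here eq) = here eq
visited-++ˡ s [] (i ∷ w) (here eq) = here eq
visited-++ˡ s (i ∷ v) w (here eq) = here eq
visited-++ˡ s (i ∷ v) w (there x∈) = there (visited-++ˡ (flip i s) v w x∈)

visited-++ʳ : (s : Point n) (v w : List (Fin n)) → ∀ {x} → x ∈ visited (endpoint s v) w → x ∈ visited s (v ++ w)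
visited-++ʳ s [] w x∈ = x∈
visited-++ʳ s (i ∷ v) w x∈ = there (visited-++ʳ (flip i s) v w x∈)

path : Point n → Point n → List (Fin n)
path [] [] = []
path (true ∷ x) (true ∷ y) = map suc (path x y)
path (true ∷ x) (false ∷ y) = zero ∷ map suc (path x y)
path (false ∷ x) (true ∷ y) = zero ∷ map suc (path x y)
path (false ∷ x) (false ∷ y) = map suc (path x y)

length-path : (x y : Point n) → length (path x y) ≡ dist x y
length-path [] [] = refl
length-path (true ∷ x) (true ∷ y) = trans (length-map suc (path x y)) (length-path x y)
length-path (true ∷ x) (false ∷ y) = cong suc (trans (length-map suc (path x y)) (length-path x y))
length-path (false ∷ x) (true ∷ y) = cong suc (trans (length-map suc (path x y)) (length-path x y))
length-path (false ∷ x) (false ∷ y) = trans (length-map suc (path x y)) (length-path x y)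

endpoint-map-suc : (b : Bool) (s : Point n) (w : List (Fin n)) → endpoint (b ∷ s) (map suc w) ≡ b ∷ endpoint s w
endpoint-map-suc b s [] = refl
endpoint-map-suc b s (i ∷ w) = endpoint-map-suc b (flip i s) w

endpoint-path : (x y : Point n) → endpoint x (path x y) ≡ y
endpoint-path [] [] = refl
endpoint-path (true ∷ x) (true ∷ y) = trans (endpoint-map-suc true x (path x y)) (cong (true ∷_) (endpoint-path x y))
endpoint-path (true ∷ x) (false ∷ y) = trans (endpoint-map-suc false x (path x y)) (cong (false ∷_) (endpoint-path x y))
endpoint-path (false ∷ x) (true ∷ y) = trans (endpoint-map-suc true x (path x y)) (cong (true ∷_) (endpoint-path x y))
endpoint-path (false ∷ x) (false ∷ y) = trans (endpoint-map-suc false x (path x y)) (cong (false ∷_) (endpoint-path x y))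

Extends : Point n → List (Fin n) → List (Fin n) → Set
Extends s w w′ = ∀ {x} → x ∈ visited s w → x ∈ visited s w′

-- A closed excursion y → x → y can be inserted wherever the walk passes through y.
detour : (s : Point n) (w : List (Fin n)) {y : Point n} (x : Point n) → y ∈ visited s w →
         ∃ λ w′ → length w′ ≡ length w + 2 * dist y x × Extends s w w′ × x ∈ visited s w′
detour s w x y∈ = go s w y∈
  where
  excursion : ∀ y w → ∃ λ w′ → length w′ ≡ length w + 2 * dist y x × Extends y w w′ × x ∈ visited y w′
  excursion y w = loop ++ w , len , keep , hit
    where
    loop = path y x ++ path x y
    closed : endpoint y loop ≡ y
    closed = trans (endpoint-++ y (path y x) (path x y))
      (trans (cong (λ z → endpoint z (path x y)) (endpoint-path y x)) (endpoint-path x y))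
    rearrange : ∀ a b → a + a + b ≡ b + 2 * a
    rearrange = solve-∀
    len : length (loop ++ w) ≡ length w + 2 * dist y x
    len = trans (length-++ loop) (trans (cong (_+ length w) (trans (length-++ (path y x))
      (cong₂ _+_ (length-path y x) (trans (length-path x y) (dist-sym x y))))) (rearrange (dist y x) (length w)))
    keep : Extends y w (loop ++ w)
    keep z∈ = visited-++ʳ y loop w (subst (λ t → _ ∈ visited t w) (sym closed) z∈)
    hit : x ∈ visited y (loop ++ w)
    hit = visited-++ˡ y loop w (visited-++ˡ y (path y x) (path x y)
      (subst (_∈ visited y (path y x)) (endpoint-path y x) (endpoint∈visited y (path y x))))
  go : ∀ s w {y} → y ∈ visited s w → ∃ λ w′ → length w′ ≡ length w + 2 * dist y x × Extends s w w′ × x ∈ visited s w′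
  go s [] (here refl) = excursion s []
  go s (i ∷ w) (here refl) = excursion s (i ∷ w)
  go s (i ∷ w) (there y∈) with w′ , len , keep , hit ← go (flip i s) w y∈ =
    i ∷ w′ , cong suc len , (λ { (here eq) → here eq ; (there z∈) → there (keep z∈) }) , there hit

origin : Point n
origin = replicate _ false

-- All tours start at the same point, so a tour is determined by its steps alone.
Tour : ℕ → List (Point n) → Set
Tour L xs = ∃ λ w → length w ≤ L × (∀ {x} → x ∈ xs → x ∈ visited origin w)

-- Tours of classes of VC dimension at most 1

Member : List (Point n) → Point n → Set
Member xs x = x ∈ xs

single : Fin n → Subset n
single zero = true ∷ replicate _ false
single (suc i) = false ∷ single i

pair : (i j : Fin n) → i ≢ j → Subset n
pair zero zero i≢j = ⊥-elim (i≢j refl)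
pair zero (suc j) _ = true ∷ single j
pair (suc i) zero _ = true ∷ single i
pair (suc i) (suc j) i≢j = false ∷ pair i j (i≢j ∘ cong suc)

1≤∣single∣ : (i : Fin n) → 1 ≤ ∣ single i ∣
1≤∣single∣ zero = s≤s z≤n
1≤∣single∣ (suc i) = 1≤∣single∣ i

2≤∣pair∣ : (i j : Fin n) (i≢j : i ≢ j) → 2 ≤ ∣ pair i j i≢j ∣
2≤∣pair∣ zero zero i≢j = ⊥-elim (i≢j refl)
2≤∣pair∣ zero (suc j) _ = s≤s (1≤∣single∣ j)
2≤∣pair∣ (suc i) zero _ = s≤s (1≤∣single∣ i)
2≤∣pair∣ (suc i) (suc j) i≢j = 2≤∣pair∣ i j (i≢j ∘ cong suc)

agree-single : (i : Fin n) (x p : Point n) → lookup x i ≡ lookup p i → Agree (single i) x p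
agree-single zero (_ ∷ x) (_ ∷ p) eq = eq , agree-∅ x p
agree-single (suc i) (_ ∷ x) (_ ∷ p) eq = agree-single i x p eq

agree-pair : (i j : Fin n) (i≢j : i ≢ j) (x p : Point n) →
             lookup x i ≡ lookup p i → lookup x j ≡ lookup p j → Agree (pair i j i≢j) x p
agree-pair zero zero i≢j x p ei ej = ⊥-elim (i≢j refl)
agree-pair zero (suc j) _ (_ ∷ x) (_ ∷ p) ei ej = ei , agree-single j x p ej
agree-pair (suc i) zero _ (_ ∷ x) (_ ∷ p) ei ej = ej , agree-single i x p ei
agree-pair (suc i) (suc j) i≢j (_ ∷ x) (_ ∷ p) ei ej = agree-pair i j (i≢j ∘ cong suc) x p ei ej

agree-lookup : (Y : Subset n) (x p : Point n) (i : Fin n) → lookup Y i ≡ true → Agree Y x p → lookup x i ≡ lookup p i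
agree-lookup (true ∷ Y) (_ ∷ x) (_ ∷ p) zero i∈Y (eq , _) = eq
agree-lookup (true ∷ Y) (_ ∷ x) (_ ∷ p) (suc i) i∈Y (_ , ag) = agree-lookup Y x p i i∈Y ag
agree-lookup (false ∷ Y) (_ ∷ x) (_ ∷ p) (suc i) i∈Y ag = agree-lookup Y x p i i∈Y ag

agree-update : (Y : Subset n) (x p : Point n) (i : Fin n) (b : Bool) → lookup Y i ≡ false →
               Agree Y (x [ i ]≔ b) p → Agree Y x p
agree-update (false ∷ Y) (_ ∷ x) (_ ∷ p) zero b i∉Y ag = ag
agree-update (true ∷ Y) (_ ∷ x) (_ ∷ p) (suc i) b i∉Y (eq , ag) = eq , agree-update Y x p i b i∉Y ag
agree-update (false ∷ Y) (_ ∷ x) (_ ∷ p) (suc i) b i∉Y ag = agree-update Y x p i b i∉Y ag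

no-four-patterns : (P : Point n → Set) → VC≤ 1 P → (i j : Fin n) → i ≢ j →
                   (∀ a b → ∃ λ x → P x × lookup x i ≡ a × lookup x j ≡ b) → ⊥
no-four-patterns P vc i j i≢j all =
  n≮n 1 (≤-trans (2≤∣pair∣ i j i≢j) (vc (pair i j i≢j) λ p →
    let x , Px , ei , ej = all (lookup p i) (lookup p j) in x , Px , agree-pair i j i≢j x p ei ej))

difference : (x y : Point n) → x ≢ y → ∃ λ i → lookup x i ≢ lookup y i
difference [] [] x≢y = ⊥-elim (x≢y refl)
difference (a ∷ x) (b ∷ y) x≢y with a ≟ᵇ b
... | no a≢b = zero , a≢b
... | yes refl with i , neq ← difference x y (x≢y ∘ cong (a ∷_)) = suc i , neq

module _ {A : Set} where
  filter-strict : {P Q : A → Set} (P? : ∀ x → Dec (P x)) (Q? : ∀ x → Dec (Q x)) (xs : List A) →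
    (∀ {x} → x ∈ xs → Q x → P x) → ∀ {z} → z ∈ xs → P z → ¬ Q z →
    length (filter Q? xs) < length (filter P? xs)
  filter-mono : {P Q : A → Set} (P? : ∀ x → Dec (P x)) (Q? : ∀ x → Dec (Q x)) (xs : List A) →
    (∀ {x} → x ∈ xs → Q x → P x) → length (filter Q? xs) ≤ length (filter P? xs)
  filter-mono P? Q? [] Q⊆P = z≤n
  filter-mono P? Q? (x ∷ xs) Q⊆P with P? x | Q? x
  ... | yes _ | yes _ = s≤s (filter-mono P? Q? xs (Q⊆P ∘ there))
  ... | yes _ | no _ = m≤n⇒m≤1+n (filter-mono P? Q? xs (Q⊆P ∘ there))
  ... | no ¬p | yes q = ⊥-elim (¬p (Q⊆P (here refl) q))
  ... | no _ | no _ = filter-mono P? Q? xs (Q⊆P ∘ there)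
  filter-strict P? Q? (x ∷ xs) Q⊆P z∈ Pz ¬Qz with P? x | Q? x | z∈
  ... | no ¬p | yes q | _ = ⊥-elim (¬p (Q⊆P (here refl) q))
  ... | no ¬p | no _ | here refl = ⊥-elim (¬p Pz)
  ... | no _ | no _ | there z∈′ = filter-strict P? Q? xs (Q⊆P ∘ there) z∈′ Pz ¬Qz
  ... | yes _ | yes q | here refl = ⊥-elim (¬Qz q)
  ... | yes _ | yes _ | there z∈′ = s≤s (filter-strict P? Q? xs (Q⊆P ∘ there) z∈′ Pz ¬Qz)
  ... | yes _ | no _ | _ = s≤s (filter-mono P? Q? xs (Q⊆P ∘ there))

  remove : {x : A} {xs : List A} → x ∈ xs →
           ∃ λ ys → length xs ≡ suc (length ys) × (∀ {y} → y ∈ xs → y ≢ x → y ∈ ys)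
  remove {xs = _ ∷ xs} (here refl) = xs , refl , λ { (here eq) y≢x → ⊥-elim (y≢x eq) ; (there y∈) _ → y∈ }
  remove {xs = z ∷ xs} (there x∈) with ys , len , sub ← remove x∈ =
    z ∷ ys , cong suc len , λ { (here eq) _ → here eq ; (there y∈) y≢x → there (sub y∈ y≢x) }

Varies : List (Point n) → Fin n → Set
Varies xs i = ∃ λ x → ∃ λ y → x ∈ xs × y ∈ xs × lookup x i ≢ lookup y i

Thin : List (Point n) → Fin n → Bool → Set
Thin xs i b = ∀ {x y} → x ∈ xs → y ∈ xs → lookup x i ≡ b → lookup y i ≡ b → x ≡ y

-- If two points of the half x_i = b differ at j, then one of the halves x_j = ± is strictly contained in it.
thin-half : (xs : List (Point n)) → VC≤ 1 (Member xs) → ∀ i₀ → ∃ λ i → ∃ λ b → Thin xs i b × (i ≡ i₀ ⊎ Varies xs i)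
-- The first coordinate tried is `i₀`, which may be constant on `xs`; every later one separates two
-- points and therefore varies. The fuel bounds the size of the current half.
thin-half xs vc i₀ = descend (suc (size i₀ true)) i₀ true ≤-refl (inj₁ refl)
  where
  size : _ → _ → ℕ
  size i b = length (filter (λ x → lookup x i ≟ᵇ b) xs)
  descend : ∀ fuel i b → size i b < fuel → i ≡ i₀ ⊎ Varies xs i →
            ∃ λ i → ∃ λ b → Thin xs i b × (i ≡ i₀ ⊎ Varies xs i)
  descend (suc fuel) i b bound origin
    with any? (λ x → any? (λ y → (lookup x i ≟ᵇ b) ×-dec ((lookup y i ≟ᵇ b) ×-dec ¬? (x ≟ᵖ y))) xs) xs
  ... | no none = i , b , (λ {x} {y} x∈ y∈ ex ey → thin x y x∈ y∈ ex ey) , origin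
    where
    thin : ∀ x y → x ∈ xs → y ∈ xs → lookup x i ≡ b → lookup y i ≡ b → x ≡ y
    thin x y x∈ y∈ ex ey with x ≟ᵖ y
    ... | yes eq = eq
    ... | no neq = ⊥-elim (none (lose x∈ (lose y∈ (ex , ey , neq))))
  ... | yes some with x , x∈ , some′ ← find some with y , y∈ , ex , ey , x≢y ← find some′
                 with j , xj≢yj ← difference x y x≢y = next (opposite true) (opposite false)
    where
    i≢j : i ≢ j
    i≢j refl = xj≢yj (trans ex (sym ey))
    Opposite : Bool → Set
    Opposite c = ∃ λ z → z ∈ xs × lookup z i ≡ not b × lookup z j ≡ c
    opposite : ∀ c → Dec (Opposite c)
    opposite c with any? (λ z → (lookup z i ≟ᵇ not b) ×-dec (lookup z j ≟ᵇ c)) xs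
    ... | yes a = let z , z∈ , ei , ej = find a in yes (z , z∈ , ei , ej)
    ... | no ¬a = no λ (z , z∈ , ei , ej) → ¬a (lose z∈ (ei , ej))
    inside-half : ∀ c → ∃ λ z → z ∈ xs × lookup z i ≡ b × lookup z j ≡ c
    inside-half c with lookup x j ≟ᵇ c | lookup y j ≟ᵇ c
    ... | yes e | _ = x , x∈ , ex , e
    ... | no _ | yes e = y , y∈ , ey , e
    ... | no ne | no nf = ⊥-elim (xj≢yj (trans (¬-not ne) (sym (¬-not nf))))
    smaller : ∀ c → ¬ Opposite c → ∃ λ i → ∃ λ b → Thin xs i b × (i ≡ i₀ ⊎ Varies xs i)
    smaller c ¬opp = descend fuel j c (<-≤-trans strict (s≤s⁻¹ bound)) (inj₂ (x , y , x∈ , y∈ , xj≢yj))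
      where
      within : ∀ {z} → z ∈ xs → lookup z j ≡ c → lookup z i ≡ b
      within {z} z∈ ej with lookup z i ≟ᵇ b
      ... | yes e = e
      ... | no ne = ⊥-elim (¬opp (z , z∈ , ¬-not ne , ej))
      -- Whichever of `x` and `y` has value `not c` at `j` is lost.
      strict : size j c < size i b
      strict = let z , z∈ , ei , ej = inside-half (not c) in
        filter-strict (λ x → lookup x i ≟ᵇ b) (λ x → lookup x j ≟ᵇ c) xs within z∈ ei (λ e → not-¬ e ej)
    next : Dec (Opposite true) → Dec (Opposite false) → ∃ λ i → ∃ λ b → Thin xs i b × (i ≡ i₀ ⊎ Varies xs i)
    next (no ¬t) _ = smaller true ¬t
    next _ (no ¬f) = smaller false ¬f
    -- Now both values at `j` occur in each of the two halves at `i`, so the pair is shattered.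
    next (yes t) (yes f) = ⊥-elim (no-four-patterns (Member xs) vc i j i≢j pattern-of)
      where
      outside-half : ∀ c → Opposite c
      outside-half true = t
      outside-half false = f
      pattern-of : ∀ a c → ∃ λ x → x ∈ xs × lookup x i ≡ a × lookup x j ≡ c
      pattern-of a c with a ≟ᵇ b
      ... | yes refl = inside-half c
      ... | no a≢b = subst (λ a → ∃ λ x → x ∈ xs × lookup x i ≡ a × lookup x j ≡ c) (sym (¬-not a≢b)) (outside-half c)

-- A set containing `i` is not shattered once this coordinate is constant, and any other set does
-- not see the update.
VC≤-update : ∀ {d} (xs : List (Point n)) (i : Fin n) (b : Bool) → VC≤ d (Member xs) →
             VC≤ d (Member (map (_[ i ]≔ b) xs))
VC≤-update xs i b vc Y sh with lookup Y i in eq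
... | false = vc Y λ p → original p (sh p)
  where
  original : ∀ p → (∃ λ x → x ∈ map (_[ i ]≔ b) xs × Agree Y x p) → ∃ λ x → x ∈ xs × Agree Y x p
  original p (x , x∈ , ag) with z , z∈ , refl ← ∈-map⁻ (_[ i ]≔ b) x∈ = z , z∈ , agree-update Y z p i b eq ag
... | true with x , x∈ , ag ← sh (replicate _ (not b)) with z , z∈ , refl ← ∈-map⁻ (_[ i ]≔ b) x∈ =
  ⊥-elim (not-¬ (lookup∘update i z b) (trans (agree-lookup Y _ _ i eq ag) (lookup-replicate i (not b))))

dist-update : (x : Point n) (i : Fin n) (b : Bool) → dist (x [ i ]≔ b) x ≤ 1
dist-update (a ∷ x) zero b = ≤-trans (+-monoˡ-≤ (dist x x) (δ≤1 b a)) (≤-reflexive (cong suc (dist-refl x)))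
  where
  δ≤1 : ∀ a b → δ a b ≤ 1
  δ≤1 true true = z≤n
  δ≤1 true false = ≤-refl
  δ≤1 false true = ≤-refl
  δ≤1 false false = z≤n
dist-update (a ∷ x) (suc i) b = subst (λ t → t + dist (x [ i ]≔ b) x ≤ 1) (sym (δ-refl a)) (dist-update x i b)

update-same : (x : Point n) (i : Fin n) (b : Bool) → lookup x i ≡ b → x [ i ]≔ b ≡ x
update-same (_ ∷ x) zero b refl = refl
update-same (a ∷ x) (suc i) b eq = cong (a ∷_) (update-same x i b eq)

-- Erasing the coordinate of a thin half moves at most one point, which a detour of length 2 recovers.
tour-VC1-varying : ∀ {N} (J : List (Fin N)) (xs : List (Point N)) → VC≤ 1 (Member xs) →
                   (∀ {i} → Varies xs i → i ∈ J) → ∀ m → length J ≡ m → Tour (N + 2 * m) xs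
tour-VC1-varying J [] vc varying m len = [] , z≤n , λ ()
tour-VC1-varying {N} [] (x ∷ xs) vc varying m len =
  -- No coordinate varies, so the class is a single point, at distance at most `N` from the origin.
  path origin x ,
  ≤-trans (≤-reflexive (length-path origin x)) (≤-trans (dist≤n origin x) (m≤m+n N _)) ,
  λ {y} y∈ → subst (_∈ visited origin (path origin x)) (constant y y∈)
    (subst (_∈ visited origin (path origin x)) (endpoint-path origin x) (endpoint∈visited origin (path origin x)))
  where
  constant : ∀ y → y ∈ x ∷ xs → x ≡ y
  constant y y∈ with x ≟ᵖ y
  ... | yes eq = eq
  ... | no neq with i , xi≢yi ← difference x y neq with () ← varying (x , y , here refl , y∈ , xi≢yi)
tour-VC1-varying {N} J@(i₀ ∷ _) xs@(_ ∷ _) vc varying (suc m) len = recover (thin-half xs vc i₀)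
  where
  i∈J : ∀ {i} → i ≡ i₀ ⊎ Varies xs i → i ∈ J
  i∈J (inj₁ refl) = here refl
  i∈J (inj₂ v) = varying v
  recover : (∃ λ i → ∃ λ b → Thin xs i b × (i ≡ i₀ ⊎ Varies xs i)) → Tour (N + 2 * suc m) xs
  recover (i , b , thin , i∈) with J′ , lenJ , sub ← remove {x = i} {xs = J} (i∈J i∈) =
    extend (tour-VC1-varying J′ (map erase xs) (VC≤-update xs i (not b) vc) varying′ m
                     (suc-injective (trans (sym lenJ) len)))
    where
    erase : Point N → Point N
    erase = _[ i ]≔ not b
    varying′ : ∀ {j} → Varies (map erase xs) j → j ∈ J′
    varying′ {j} (_ , _ , x∈ , y∈ , xj≢yj)
      with x , x∈′ , refl ← ∈-map⁻ erase x∈ with y , y∈′ , refl ← ∈-map⁻ erase y∈ = sub (varying (x , y , x∈′ , y∈′ , differ)) j≢i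
      where
      j≢i : j ≢ i
      j≢i refl = xj≢yj (trans (lookup∘update i x (not b)) (sym (lookup∘update i y (not b))))
      differ : lookup x j ≢ lookup y j
      differ eq = xj≢yj (trans (lookup∘update′ j≢i x (not b)) (trans eq (sym (lookup∘update′ j≢i y (not b)))))
    grow : N + 2 * m + 2 ≡ N + 2 * suc m
    grow = trans (+-assoc N (2 * m) 2) (cong (N +_) (trans (+-comm (2 * m) 2) (sym (*-suc 2 m))))
    unmoved : ∀ {x} → lookup x i ≢ b → x ∈ xs → x ∈ map erase xs
    unmoved {x} xi≢b x∈ = subst (_∈ map erase xs) (update-same x i (not b) (¬-not xi≢b)) (∈-map⁺ erase x∈)
    extend : Tour (N + 2 * m) (map erase xs) → Tour (N + 2 * suc m) xs
    extend (w , lw , cover) with any? (λ x → lookup x i ≟ᵇ b) xs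
    ... | no none = w , ≤-trans lw (≤-trans (m≤m+n _ 2) (≤-reflexive grow)) ,
                    λ x∈ → cover (unmoved (λ e → none (lose x∈ e)) x∈)
    ... | yes some with z , z∈ , zi ← find some
                   with w′ , lw′ , keep , hit ← detour origin w z (cover (∈-map⁺ erase z∈)) =
      w′ , ≤-trans (≤-reflexive lw′) (≤-trans (+-mono-≤ lw (*-monoʳ-≤ 2 (dist-update z i (not b)))) (≤-reflexive grow)) , covered
      where
      covered : ∀ {x} → x ∈ xs → x ∈ visited origin w′
      covered {x} x∈ with lookup x i ≟ᵇ b
      ... | yes e = subst (_∈ visited origin w′) (thin z∈ x∈ zi e) hit
      ... | no ne = keep (cover (unmoved ne x∈))

tour-VC1 : ∀ {N} (xs : List (Point N)) → VC≤ 1 (Member xs) → Tour (N + 2 * N) xs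
tour-VC1 {N} xs vc = tour-VC1-varying (allFin N) xs vc (λ _ → ∈-allFin _) N (length-tabulate id)

-- Lists of points as weights on the cube

indicator : Point n → Point n → ℕ
indicator [] [] = 1
indicator (true ∷ x) (true ∷ y) = indicator x y
indicator (true ∷ x) (false ∷ y) = 0
indicator (false ∷ x) (true ∷ y) = 0
indicator (false ∷ x) (false ∷ y) = indicator x y

Σₚ-indicator : (y : Point n) → Σₚ n (indicator y) ≡ 1
Σₚ-indicator [] = refl
Σₚ-indicator {suc n} (true ∷ y) = cong₂ _+_ (Σₚ-indicator y) (Σₚ-zero n)
Σₚ-indicator {suc n} (false ∷ y) = cong₂ _+_ (Σₚ-zero n) (Σₚ-indicator y)

indicator-cases : (y x : Point n) → indicator y x ≡ 0 ⊎ (y ≡ x × indicator y x ≡ 1)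
indicator-cases [] [] = inj₂ (refl , refl)
indicator-cases (true ∷ y) (true ∷ x) with indicator-cases y x
... | inj₁ e = inj₁ e
... | inj₂ (refl , e) = inj₂ (refl , e)
indicator-cases (true ∷ y) (false ∷ x) = inj₁ refl
indicator-cases (false ∷ y) (true ∷ x) = inj₁ refl
indicator-cases (false ∷ y) (false ∷ x) with indicator-cases y x
... | inj₁ e = inj₁ e
... | inj₂ (refl , e) = inj₂ (refl , e)

occurrences : List (Point n) → Point n → ℕ
occurrences [] x = 0
occurrences (y ∷ M) x = indicator y x + occurrences M x

Σₚ-occurrences : (M : List (Point n)) → Σₚ n (occurrences M) ≡ length M
Σₚ-occurrences {n} [] = Σₚ-zero n
Σₚ-occurrences {n} (y ∷ M) = trans (Σₚ-+ n (indicator y) (occurrences M)) (cong₂ _+_ (Σₚ-indicator y) (Σₚ-occurrences M))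

occurrences⇒∈ : (M : List (Point n)) (x : Point n) → 0 < occurrences M x → x ∈ M
occurrences⇒∈ (y ∷ M) x pos with indicator-cases y x
... | inj₂ (refl , _) = here refl
... | inj₁ e = there (occurrences⇒∈ M x (subst (λ t → 0 < t + occurrences M x) e pos))

SeparatedList : ℕ → List (Point n) → Set
SeparatedList k = AllPairs (λ x y → k ≤ dist x y)

-- A repeated point would be at distance 0 from its copy, whereas separation demands at least k ≥ 1.
occurrences≤1 : ∀ k .{{_ : NonZero k}} (M : List (Point n)) → SeparatedList k M → ∀ x → occurrences M x ≤ 1
occurrences≤1 k [] [] x = z≤n
occurrences≤1 (suc k) (y ∷ M) (far ∷ sep) x with indicator-cases y x
... | inj₁ e = subst (λ t → t + occurrences M x ≤ 1) (sym e) (occurrences≤1 (suc k) M sep x)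
... | inj₂ (refl , e) = subst (λ t → t + occurrences M x ≤ 1) (sym e) (s≤s (≮⇒≥ λ pos →
  n≮0 (subst (suc k ≤_) (dist-refl x) (All.lookup far (occurrences⇒∈ M x pos)))))

separated-∈ : ∀ {k} {M : List (Point n)} → SeparatedList k M → ∀ {x y} → x ∈ M → y ∈ M → x ≢ y → k ≤ dist x y
separated-∈ (_ ∷ _) (here refl) (here refl) x≢y = ⊥-elim (x≢y refl)
separated-∈ (far ∷ _) (here refl) (there y∈) _ = All.lookup far y∈
separated-∈ {k = k} (far ∷ _) {x} {y} (there x∈) (here refl) _ = subst (k ≤_) (dist-sym y x) (All.lookup far x∈)
separated-∈ (_ ∷ sep) (there x∈) (there y∈) x≢y = separated-∈ sep x∈ y∈ x≢y

packing-list : ∀ {N} d k .{{_ : NonZero N}} .{{_ : NonZero d}} .{{_ : NonZero k}} → k ≤ N →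
  (M : List (Point N)) → VC≤ d (Member M) → SeparatedList k M →
  length M * k ^ d ≤ 2 * (4 ^ (4 * d) * N ^ d)
packing-list {N} d k k≤N M vc sep = subst (λ t → t * k ^ d ≤ _) (Σₚ-occurrences M)
  (packing N d k k≤N (occurrences M) (VC≤-antitone (λ {x} → occurrences⇒∈ M x) vc) (occurrences≤1 k M sep)
    λ x y x≢y px py → separated-∈ sep (occurrences⇒∈ M x px) (occurrences⇒∈ M y py) x≢y)

-- Tours through nets

module Nets {N : ℕ} (xs : List (Point N)) where

  Walk : Set
  Walk = List (Fin N)

  Visits : Walk → List (Point N) → Set
  Visits w M = ∀ {y} → y ∈ M → y ∈ visited origin w

  Near : ℕ → List (Point N) → Point N → Set
  Near r M x = ∃ λ y → y ∈ M × dist y x < r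

  -- Greedy completion: a point at distance at least `k` from the current net is added. It is within
  -- `k` of the net because the initial net has scale k + 1, so its detour costs at most 2k. The
  -- length inequality records this cost per added point without subtraction.
  refine : ∀ k .{{_ : NonZero k}} (zs : List (Point N)) (M : List (Point N)) (w : Walk) →
    All (_∈ xs) zs → All (_∈ xs) M → SeparatedList k M → Visits w M → (∀ {z} → z ∈ zs → Near (suc k) M z) →
    ∃ λ M′ → ∃ λ w′ → All (_∈ xs) M′ × SeparatedList k M′ × Visits w′ M′ × (∀ {y} → y ∈ M → y ∈ M′) ×
      (∀ {z} → z ∈ zs → Near k M′ z) ×
      length w′ + 2 * (k * length M) ≤ length w + 2 * (k * length M′)
  refine k [] M w _ M⊆ sep vis near = M , w , M⊆ , sep , vis , id , (λ ()) , ≤-refl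
  refine k@(suc k-1) (z ∷ zs) M w (z∈ ∷ zs⊆) M⊆ sep vis near with all? (λ y → k ≤? dist z y) M
  ... | no ¬far with M′ , w′ , M′⊆ , sep′ , vis′ , M⊆M′ , near′ , len ← refine k zs M w zs⊆ M⊆ sep vis (near ∘ there)
                with y , y∈ , close ← find (¬All⇒Any¬ (λ y → k ≤? dist z y) M ¬far) =
    M′ , w′ , M′⊆ , sep′ , vis′ , M⊆M′ ,
    (λ { (here refl) → y , M⊆M′ y∈ , subst (_< k) (dist-sym z y) (≰⇒> close) ; (there z∈) → near′ z∈ }) , len
  ... | yes far with y , y∈ , d≤k ← near (here refl)
                with w₁ , len₁ , keep , hit ← detour origin w z (vis y∈)
                with M′ , w′ , M′⊆ , sep′ , vis′ , M⊆M′ , near′ , len ←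
                       refine k zs (z ∷ M) w₁ zs⊆ (z∈ ∷ M⊆) (far ∷ sep)
                         (λ { (here refl) → hit ; (there y∈) → keep (vis y∈) })
                         (λ z∈ → let y , y∈ , d< = near (there z∈) in y , there y∈ , d<) =
    M′ , w′ , M′⊆ , sep′ , vis′ , M⊆M′ ∘ there ,
    (λ { (here refl) → z , M⊆M′ (here refl) , subst (_< k) (sym (dist-refl z)) z<s ; (there z∈) → near′ z∈ }) ,
    +-cancelˡ-≤ (2 * k) _ _ (begin
      2 * k + (length w′ + 2 * (k * length M))       ≡⟨ e₁ k (length w′) (length M) ⟩
      length w′ + 2 * (k * suc (length M))           ≤⟨ len ⟩
      length w₁ + 2 * (k * length M′)                ≡⟨ cong (_+ 2 * (k * length M′)) len₁ ⟩
      length w + 2 * dist y z + 2 * (k * length M′)  ≤⟨ +-monoˡ-≤ _ (+-monoʳ-≤ (length w) (*-monoʳ-≤ 2 (s≤s⁻¹ d≤k))) ⟩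
      length w + 2 * k + 2 * (k * length M′)         ≡⟨ e₂ (length w) (2 * k) (2 * (k * length M′)) ⟩
      2 * k + (length w + 2 * (k * length M′))       ∎)
    where
    open ≤-Reasoning
    e₁ : ∀ k a b → 2 * k + (a + 2 * (k * b)) ≡ a + 2 * (k * suc b)
    e₁ k a b = trans (e₁′ k a b) (cong (λ t → a + 2 * t) (sym (*-suc k b)))
      where
      e₁′ : ∀ k a b → 2 * k + (a + 2 * (k * b)) ≡ a + 2 * (k + k * b)
      e₁′ = solve-∀
    e₂ : ∀ a b c → a + b + c ≡ b + (a + c)
    e₂ = solve-∀

  -- With M_j the net of scale j, S stands for the sum of ∣M_j∣ over j > k, so that the length bound is
  -- an Abel summation of Σ j (∣M_j∣ − ∣M_{j+1}∣), and k * S ≤ A because Σ_{j > k} 1/j² ≤ 1/k.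
  record Net (A k : ℕ) : Set where
    field
      M : List (Point N)
      w : Walk
      S : ℕ
      M⊆ : All (_∈ xs) M
      sep : SeparatedList k M
      vis : Visits w M
      near : ∀ {x} → x ∈ xs → Near k M x
      len : length w ≤ N + 2 * (k * length M) + 2 * S
      tail : k * S ≤ A

  module _ (A : ℕ) (packed : ∀ k → 1 ≤ k → k ≤ suc N → (M : List (Point N)) → All (_∈ xs) M →
                             SeparatedList k M → length M * (k * k) ≤ A) where

    finer : ∀ k → 1 ≤ k → k ≤ N → Net A (suc k) → Net A k
    finer k@(suc k-1) 1≤k k≤N net
      with M′ , w′ , M′⊆ , sep′ , vis′ , _ , near′ , len′ ← refine k xs (Net.M net) (Net.w net) (All.tabulate id) (Net.M⊆ net)
               (AllPairs.map (≤-trans (n≤1+n k)) (Net.sep net)) (Net.vis net) (Net.near net) =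
      record { M = M′ ; w = w′ ; S = S + length M ; M⊆ = M′⊆ ; sep = sep′ ; vis = vis′ ; near = near′
                     ; len = len″ ; tail = tail″ }
      where
      open Net net
      open ≤-Reasoning
      e₁ : ∀ w k m → 2 * (k * m) + w ≡ w + 2 * (k * m)
      e₁ w k m = +-comm (2 * (k * m)) w
      e₂ : ∀ N k m S m′ → N + 2 * (m + k * m) + 2 * S + 2 * (k * m′) ≡ 2 * (k * m) + (N + 2 * (k * m′) + 2 * (S + m))
      e₂ = solve-∀
      len″ : length w′ ≤ N + 2 * (k * length M′) + 2 * (S + length M)
      len″ = +-cancelˡ-≤ (2 * (k * length M)) _ _ (begin
        2 * (k * length M) + length w′                                ≡⟨ e₁ (length w′) k (length M) ⟩
        length w′ + 2 * (k * length M)                                ≤⟨ len′ ⟩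
        length w + 2 * (k * length M′)                                ≤⟨ +-monoˡ-≤ _ len ⟩
        N + 2 * (suc k * length M) + 2 * S + 2 * (k * length M′)      ≡⟨ e₂ N k (length M) S (length M′) ⟩
        2 * (k * length M) + (N + 2 * (k * length M′) + 2 * (S + length M)) ∎)
      e₃ : ∀ k S m → (1 + k) * (k * (S + m)) ≡ k * ((1 + k) * S) + k * (1 + k) * m
      e₃ = solve-∀
      tail″ : k * (S + length M) ≤ A
      -- This is 1/(k+1) + 1/(k+1)² ≤ 1/k with denominators cleared: the old sum contributes at most
      -- k A, the packing bound at scale k + 1 another A.
      tail″ = *-cancelˡ-≤ (suc k) (begin
        suc k * (k * (S + length M))                 ≡⟨ e₃ k S (length M) ⟩
        k * (suc k * S) + k * suc k * length M       ≤⟨ +-mono-≤ (*-monoʳ-≤ k tail) (*-monoˡ-≤ (length M) (*-monoˡ-≤ (suc k) (n≤1+n k))) ⟩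
        k * A + suc k * suc k * length M             ≡⟨ cong (k * A +_) (*-comm (suc k * suc k) (length M)) ⟩
        k * A + length M * (suc k * suc k)           ≤⟨ +-monoʳ-≤ (k * A) (packed (suc k) (s≤s z≤n) (s≤s k≤N) M M⊆ sep) ⟩
        k * A + A                                    ≡⟨ +-comm (k * A) A ⟩
        suc k * A                                    ∎)

    -- No distance exceeds `N`, so at scale N + 1 any single point is a net.
    coarsest : ∀ {x₀} → x₀ ∈ xs → Net A (suc N)
    coarsest {x₀} x₀∈ = record
      { M = x₀ ∷ [] ; w = path origin x₀ ; S = 0 ; M⊆ = x₀∈ ∷ [] ; sep = [] ∷ []
      ; vis = λ { (here refl) → subst (_∈ visited origin (path origin x₀)) (endpoint-path origin x₀) (endpoint∈visited origin (path origin x₀)) }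
      ; near = λ {x} _ → x₀ , here refl , s≤s (dist≤n x₀ x)
      ; len = ≤-trans (≤-reflexive (length-path origin x₀)) (≤-trans (dist≤n origin x₀) (≤-trans (m≤m+n N _) (m≤m+n _ _)))
      ; tail = ≤-trans (≤-reflexive (*-zeroʳ N)) z≤n }

    descend : ∀ k → k ≤ N → Net A (suc k) → Net A 1
    descend zero _ net = net
    descend (suc k) k<N net = descend k (<⇒≤ k<N) (finer (suc k) (s≤s z≤n) k<N net)

    -- At scale 1 the net is the whole class, since distance below 1 means equality. The net itself
    -- and the tail sum `S` each contribute 2A to the length.
    tour : ∀ {x₀} → x₀ ∈ xs → Tour (N + 4 * A) xs
    tour x₀∈ = w , length-bound , λ {x} x∈ → covered x (near x∈)
      where
      open Net (descend N ≤-refl (coarsest x₀∈))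
      open ≤-Reasoning
      e₁ : ∀ N A → N + 2 * A + 2 * A ≡ N + 4 * A
      e₁ = solve-∀
      length-bound : length w ≤ N + 4 * A
      length-bound = begin
        length w                            ≤⟨ len ⟩
        N + 2 * (1 * length M) + 2 * S      ≤⟨ +-mono-≤ (+-monoʳ-≤ N (*-monoʳ-≤ 2 (begin
          1 * length M    ≡⟨ *-comm 1 (length M) ⟩
          length M * 1    ≤⟨ packed 1 ≤-refl (s≤s z≤n) M M⊆ sep ⟩
          A               ∎))) (*-monoʳ-≤ 2 (≤-trans (≤-reflexive (sym (*-identityˡ S))) tail)) ⟩
        N + 2 * A + 2 * A                   ≡⟨ e₁ N A ⟩
        N + 4 * A                           ∎
      covered : ∀ x → Near 1 M x → x ∈ visited origin w
      covered x (y , y∈ , d<1) = subst (_∈ visited origin w) (dist≡0⇒≡ y x (n<1⇒n≡0 d<1)) (vis y∈)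

packing-constant : ℕ → ℕ → ℕ
packing-constant N d = 2 * (4 ^ (4 * d) * N ^ d)

tour-VC≥2 : ∀ {N} .{{_ : NonZero N}} d → 2 ≤ d → (xs : List (Point N)) → VC≤ d (Member xs) →
            Tour (N + 4 * packing-constant N d) xs
tour-VC≥2 d 2≤d [] vc = [] , z≤n , λ ()
tour-VC≥2 {N} d 2≤d xs@(x₀ ∷ _) vc = Nets.tour xs (packing-constant N d) packed (here refl)
  where
  open ≤-Reasoning
  instance
    d≢0 : NonZero d
    d≢0 = >-nonZero (≤-trans (s≤s z≤n) 2≤d)
  A = packing-constant N d
  square : ∀ k .{{_ : NonZero k}} → k * k ≤ k ^ d
  square k = begin
    k * k        ≡⟨ cong (k *_) (*-identityʳ k) ⟨
    k ^ 2        ≤⟨ ^-monoʳ-≤ k 2≤d ⟩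
    k ^ d        ∎
  -- The packing lemma covers k ≤ N. At scale N + 1 a separated list has at most one point, and the
  -- constant absorbs (N + 1)ᵈ ≤ (2N)ᵈ.
  N-case : (M : List (Point N)) → SeparatedList (suc N) M → length M * (suc N * suc N) ≤ A
  N-case [] _ = z≤n
  N-case (x ∷ y ∷ M) ((far ∷ _) ∷ _) = ⊥-elim (n≮n N (≤-trans far (dist≤n x y)))
  N-case (x ∷ []) _ = begin
    1 * (suc N * suc N)        ≡⟨ *-identityˡ _ ⟩
    suc N * suc N              ≤⟨ square (suc N) ⟩
    suc N ^ d                  ≤⟨ ^-monoˡ-≤ d (begin
      1 + N                      ≤⟨ +-monoˡ-≤ N (>-nonZero⁻¹ N) ⟩
      N + N                      ≡⟨ cong (N +_) (+-identityʳ N) ⟨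
      2 * N                      ∎) ⟩
    (2 * N) ^ d                ≡⟨ ^-distribʳ-* d 2 N ⟩
    2 ^ d * N ^ d              ≤⟨ *-monoˡ-≤ (N ^ d) (≤-trans (^-monoˡ-≤ d {2} {4} (s≤s (s≤s z≤n))) (^-monoʳ-≤ 4 (m≤n*m d 4))) ⟩
    4 ^ (4 * d) * N ^ d        ≤⟨ m≤n*m _ 2 ⟩
    A                          ∎
  packed : ∀ k → 1 ≤ k → k ≤ suc N → (M : List (Point N)) → All (_∈ xs) M → SeparatedList k M → length M * (k * k) ≤ A
  packed k@(suc _) 1≤k k≤1+N M M⊆ sep with k ≤? N
  ... | no k≰N with refl ← ≤-antisym k≤1+N (≰⇒> k≰N) = N-case M sep
  ... | yes k≤N = ≤-trans (*-monoʳ-≤ (length M) (square k))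
                    (packing-list d k k≤N M (VC≤-antitone (All.lookup M⊆) vc) sep)

-- Classes and their VC dimension

⟦_⟧ : Class n → Point n → Set
⟦ C ⟧ x = x ∈ᶜ C ≡ true

module _ {A : Set} (p : A → Bool) where

  all-true⁺ : ∀ xs → (∀ {x} → x ∈ xs → p x ≡ true) → all p xs ≡ true
  all-true⁺ [] h = refl
  all-true⁺ (x ∷ xs) h rewrite h (here refl) = all-true⁺ xs (h ∘ there)

  all-true⁻ : ∀ xs → all p xs ≡ true → ∀ {x} → x ∈ xs → p x ≡ true
  all-true⁻ (x ∷ xs) h y∈ with p x in eq | y∈
  ... | true | here refl = eq
  ... | true | there y∈′ = all-true⁻ xs h y∈′

  any-true⁺ : ∀ xs {x} → x ∈ xs → p x ≡ true → any p xs ≡ true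
  any-true⁺ (x ∷ xs) (here refl) px rewrite px = refl
  any-true⁺ (x ∷ xs) (there y∈) py rewrite any-true⁺ xs y∈ py = ∨-zeroʳ (p x)

  any-true⁻ : ∀ xs → any p xs ≡ true → ∃ λ x → p x ≡ true
  any-true⁻ (x ∷ xs) h with p x in eq
  ... | true = x , eq
  ... | false = any-true⁻ xs h

∧-true⁻ : ∀ a {b} → a ∧ b ≡ true → a ≡ true × b ≡ true
∧-true⁻ true h = refl , h

∈-allPoints : (x : Point n) → x ∈ allPoints n
∈-allPoints [] = here refl
∈-allPoints (true ∷ x) = ∈-++⁺ˡ (∈-map⁺ (true ∷_) (∈-allPoints x))
∈-allPoints {suc n} (false ∷ x) = ∈-++⁺ʳ (map (true ∷_) (allPoints n)) (∈-map⁺ (false ∷_) (∈-allPoints x))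

agreeOn⇒Agree : (Y : Subset n) (x p : Point n) → agreeOn Y x p ≡ true → Agree Y x p
agreeOn⇒Agree [] [] [] h = tt
agreeOn⇒Agree (false ∷ Y) (_ ∷ x) (_ ∷ p) h = agreeOn⇒Agree Y x p h
agreeOn⇒Agree (true ∷ Y) (true ∷ x) (true ∷ p) h = refl , agreeOn⇒Agree Y x p h
agreeOn⇒Agree (true ∷ Y) (false ∷ x) (false ∷ p) h = refl , agreeOn⇒Agree Y x p h

Agree⇒agreeOn : (Y : Subset n) (x p : Point n) → Agree Y x p → agreeOn Y x p ≡ true
Agree⇒agreeOn [] [] [] h = refl
Agree⇒agreeOn (false ∷ Y) (_ ∷ x) (_ ∷ p) h = Agree⇒agreeOn Y x p h
Agree⇒agreeOn (true ∷ Y) (true ∷ x) (true ∷ p) (refl , h) = Agree⇒agreeOn Y x p h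
Agree⇒agreeOn (true ∷ Y) (false ∷ x) (false ∷ p) (refl , h) = Agree⇒agreeOn Y x p h

shatters⇒Shatters : (C : Class n) (Y : Subset n) → shatters C Y ≡ true → Shatters ⟦ C ⟧ Y
shatters⇒Shatters {n} C Y h p =
  let x , hx = any-true⁻ _ (allPoints n) (all-true⁻ _ (allPoints n) h (∈-allPoints p))
      x∈C , ag = ∧-true⁻ (x ∈ᶜ C) hx
  in x , x∈C , agreeOn⇒Agree Y x p ag

Shatters⇒shatters : (C : Class n) (Y : Subset n) → Shatters ⟦ C ⟧ Y → shatters C Y ≡ true
Shatters⇒shatters {n} C Y sh = all-true⁺ _ (allPoints n) λ {p} _ →
  let x , x∈C , ag = sh p in any-true⁺ _ (allPoints n) (∈-allPoints x) (cong₂ _∧_ x∈C (Agree⇒agreeOn Y x p ag))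

VCdim⇒VC≤ : (C : Class n) → VC≤ (VCdim C) ⟦ C ⟧
VCdim⇒VC≤ {n} C Y sh = ≤-trans (≤-reflexive (sym size-counted)) (maximum (allSubsets n) (∈-allPoints Y))
  where
  size : Subset n → ℕ
  size Y = if shatters C Y then ∣ Y ∣ else 0
  size-counted : size Y ≡ ∣ Y ∣
  size-counted rewrite Shatters⇒shatters C Y sh = refl
  maximum : ∀ Ys {Y} → Y ∈ Ys → size Y ≤ foldr _⊔_ 0 (map size Ys)
  maximum (Z ∷ Ys) (here refl) = m≤m⊔n (size Z) _
  maximum (Z ∷ Ys) (there Y∈) = ≤-trans (maximum Ys Y∈) (m≤n⊔m (size Z) _)

VC≤⇒VCdim : ∀ {d} (C : Class n) → VC≤ d ⟦ C ⟧ → VCdim C ≤ d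
VC≤⇒VCdim {n} {d} C vc = bounded (allSubsets n)
  where
  size : Subset n → ℕ
  size Y = if shatters C Y then ∣ Y ∣ else 0
  size≤d : ∀ Y → size Y ≤ d
  size≤d Y with shatters C Y in eq
  ... | true = vc Y (shatters⇒Shatters C Y eq)
  ... | false = z≤n
  bounded : ∀ Ys → foldr _⊔_ 0 (map size Ys) ≤ d
  bounded [] = z≤n
  bounded (Y ∷ Ys) = ⊔-lub (size≤d Y) (bounded Ys)

class-ext : ∀ n {C D : Class n} → (∀ x → x ∈ᶜ C ≡ x ∈ᶜ D) → C ≡ D
class-ext zero h = h []
class-ext (suc n) {C₁ , C₀} {D₁ , D₀} h = cong₂ _,_ (class-ext n (h ∘ (true ∷_))) (class-ext n (h ∘ (false ∷_)))

comprehension : ∀ n → (Point n → Bool) → Class n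
comprehension zero P = P []
comprehension (suc n) P = comprehension n (P ∘ (true ∷_)) , comprehension n (P ∘ (false ∷_))

∈-comprehension : ∀ n (P : Point n → Bool) x → x ∈ᶜ comprehension n P ≡ P x
∈-comprehension zero P [] = refl
∈-comprehension (suc n) P (true ∷ x) = ∈-comprehension n (P ∘ (true ∷_)) x
∈-comprehension (suc n) P (false ∷ x) = ∈-comprehension n (P ∘ (false ∷_)) x

-- Counting classes

concatMap-pairs : {A B : Set} (xs : List A) (ys : List B) →
                  concatMap (λ a → map (a ,_) ys) xs ≡ cartesianProduct xs ys
concatMap-pairs [] ys = refl
concatMap-pairs (x ∷ xs) ys = cong (map (x ,_) ys ++_) (concatMap-pairs xs ys)

∈-allClasses : ∀ n (C : Class n) → C ∈ allClasses n
∈-allClasses zero true = here refl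
∈-allClasses zero false = there (here refl)
∈-allClasses (suc n) (C , D) = subst ((C , D) ∈_) (sym (concatMap-pairs (allClasses n) (allClasses n)))
  (∈-cartesianProduct⁺ (∈-allClasses n C) (∈-allClasses n D))

allClasses-unique : ∀ n → Unique (allClasses n)
allClasses-unique zero = ((λ ()) ∷ []) ∷ [] ∷ []
allClasses-unique (suc n) = subst Unique (sym (concatMap-pairs (allClasses n) (allClasses n)))
  (cartesianProduct⁺ (allClasses-unique n) (allClasses-unique n))

unique-⊆-length : {A : Set} {xs ys : List A} → Unique xs → (∀ {x} → x ∈ xs → x ∈ ys) → length xs ≤ length ys
unique-⊆-length [] sub = z≤n
unique-⊆-length (x∉xs ∷ u) sub with zs , len , rest ← remove (sub (here refl)) =
  ≤-trans (s≤s (unique-⊆-length u λ y∈ → rest (sub (there y∈)) λ { refl → All.lookup x∉xs y∈ refl })) (≤-reflexive (sym len))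

c-upper : ∀ N d (Cs : List (Class N)) → (∀ C → VCdim C ≡ d → C ∈ Cs) → c N d ≤ length Cs
c-upper N d Cs complete = unique-⊆-length (unique-filter⁺ _ (allClasses-unique N)) λ {C} C∈ →
  complete C (≡ᵇ⇒≡ (VCdim C) d (proj₂ (∈-filter⁻ (T? ∘ (λ C → VCdim C ≡ᵇ d)) {xs = allClasses N} C∈)))

c-lower : ∀ N d (Cs : List (Class N)) → Unique Cs → (∀ {C} → C ∈ Cs → VCdim C ≡ d) → length Cs ≤ c N d
c-lower N d Cs unique sound = unique-⊆-length unique λ {C} C∈ →
  ∈-filter⁺ (T? ∘ (λ C → VCdim C ≡ᵇ d)) (∈-allClasses N C) (≡⇒≡ᵇ (VCdim C) d (sound C∈))

length-cartesianProductWith : {A B D : Set} (f : A → B → D) (xs : List A) (ys : List B) →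
                              length (cartesianProductWith f xs ys) ≡ length xs * length ys
length-cartesianProductWith f [] ys = refl
length-cartesianProductWith f (x ∷ xs) ys = trans (length-++ (map (f x) ys))
  (cong₂ _+_ (length-map (f x) ys) (length-cartesianProductWith f xs ys))

words : {A : Set} (L : ℕ) → List A → List (Vec A L)
words zero xs = [] ∷ []
words (suc L) xs = cartesianProductWith _∷_ xs (words L xs)

length-words : {A : Set} (L : ℕ) (xs : List A) → length (words L xs) ≡ length xs ^ L
length-words zero xs = refl
length-words (suc L) xs = trans (length-cartesianProductWith _∷_ xs (words L xs)) (cong (length xs *_) (length-words L xs))

-- Marked walks

Step : ℕ → Set
Step N = Bool × Fin N

at : Point n → Point n → Bool
at s x = does (s ≟ᵖ x)

-- A step carries a coordinate to flip and the mark of the point reached.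
marked : ∀ {L} → Point n → Vec (Step n) L → Point n → Bool
marked s [] x = false
marked s ((b , i) ∷ W) x = (b ∧ at (flip i s) x) ∨ marked (flip i s) W x

-- The bit `b` is the mark of the starting point, which the marks on the steps do not cover
-- initially.
decode : ∀ {L} → Bool → Vec (Step n) L → Class n
decode b W = comprehension _ λ x → (b ∧ at origin x) ∨ marked origin W x

module _ (C : Class n) (i₀ : Fin n) where

  -- Short walks are padded to length `L` by flipping `i₀`. Every mark records true membership in
  -- `C`, so padding adds no wrong point.
  mark : ∀ L → Point n → List (Fin n) → Vec (Step n) L
  mark zero s w = []
  mark (suc L) s [] = (flip i₀ s ∈ᶜ C , i₀) ∷ mark L (flip i₀ s) []
  mark (suc L) s (i ∷ w) = (flip i s ∈ᶜ C , i) ∷ mark L (flip i s) w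

  only-marked : ∀ s x → x ∈ᶜ C ≡ false → (s ∈ᶜ C) ∧ at s x ≡ false
  only-marked s x x∉ with s ≟ᵖ x
  ... | yes refl = trans (∧-identityʳ _) x∉
  ... | no _ = ∧-zeroʳ _

  mark-sound : ∀ L s w x → x ∈ᶜ C ≡ false → marked s (mark L s w) x ≡ false
  mark-sound zero s w x x∉ = refl
  mark-sound (suc L) s [] x x∉ = cong₂ _∨_ (only-marked (flip i₀ s) x x∉) (mark-sound L _ [] x x∉)
  mark-sound (suc L) s (i ∷ w) x x∉ = cong₂ _∨_ (only-marked (flip i s) x x∉) (mark-sound L _ w x x∉)

  marked-here : ∀ s → s ∈ᶜ C ≡ true → (s ∈ᶜ C) ∧ at s s ≡ true
  marked-here s s∈ = cong₂ _∧_ s∈ (dec-true (s ≟ᵖ s) refl)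

  mark-complete : ∀ L s w x → length w ≤ L → x ∈ᶜ C ≡ true → x ∈ visited s w →
                  ((s ∈ᶜ C) ∧ at s x) ∨ marked s (mark L s w) x ≡ true
  mark-complete L s [] x _ x∈ (here refl) = cong (_∨ marked s (mark L s []) s) (marked-here s x∈)
  mark-complete L s (i ∷ w) x _ x∈ (here refl) = cong (_∨ marked s (mark L s (i ∷ w)) s) (marked-here s x∈)
  mark-complete (suc L) s (i ∷ w) x (s≤s len) x∈ (there x∈′) =
    trans (cong (((s ∈ᶜ C) ∧ at s x) ∨_) (mark-complete L (flip i s) w x len x∈ x∈′)) (∨-zeroʳ _)

  decode-mark : ∀ L w → length w ≤ L → (∀ x → x ∈ᶜ C ≡ true → x ∈ visited origin w) →
                decode (origin ∈ᶜ C) (mark L origin w) ≡ C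
  decode-mark L w len cover = class-ext _ λ x → trans (∈-comprehension _ _ x) (member x)
    where
    member : ∀ x → ((origin ∈ᶜ C) ∧ at origin x) ∨ marked origin (mark L origin w) x ≡ x ∈ᶜ C
    member x with x ∈ᶜ C in eq
    ... | true = mark-complete L origin w x len eq (cover x eq)
    ... | false = cong₂ _∨_ (only-marked origin x eq) (mark-sound L origin w x eq)

bits : List Bool
bits = true ∷ false ∷ []

∈-bits : ∀ b → b ∈ bits
∈-bits true = here refl
∈-bits false = there (here refl)

∈-words : {A : Set} {xs : List A} → (∀ x → x ∈ xs) → ∀ {L} (W : Vec A L) → W ∈ words L xs
∈-words all∈ [] = here refl
∈-words all∈ (x ∷ W) = ∈-cartesianProductWith⁺ _∷_ (all∈ x) (∈-words all∈ W)

steps : ∀ N → List (Step N)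
steps N = cartesianProduct bits (allFin N)

toured-classes : ∀ N L → List (Class N)
toured-classes N L = cartesianProductWith decode bits (words L (steps N))

length-toured-classes : ∀ N L → length (toured-classes N L) ≡ 2 * (2 * N) ^ L
length-toured-classes N L = trans (length-cartesianProductWith decode bits (words L (steps N)))
  (cong (2 *_) (trans (length-words L (steps N))
    (cong (_^ L) (trans (length-cartesianProductWith _,_ bits (allFin N)) (cong (2 *_) (length-tabulate {n = N} id))))))

members : Class n → List (Point n)
members {n} C = filter (λ x → T? (x ∈ᶜ C)) (allPoints n)

∈-members⁺ : (C : Class n) {x : Point n} → ⟦ C ⟧ x → x ∈ members C
∈-members⁺ C {x} x∈ = ∈-filter⁺ (λ x → T? (x ∈ᶜ C)) (∈-allPoints x) (Equivalence.from T-≡ x∈)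

∈-members⁻ : (C : Class n) {x : Point n} → x ∈ members C → ⟦ C ⟧ x
∈-members⁻ {n} C x∈ = Equivalence.to T-≡ (proj₂ (∈-filter⁻ (λ x → T? (x ∈ᶜ C)) {xs = allPoints n} x∈))

∈-toured-classes : ∀ {N L} → 0 < N → (C : Class N) → Tour L (members C) → C ∈ toured-classes N L
∈-toured-classes {suc N} {L} _ C (w , len , cover) = subst (_∈ toured-classes (suc N) L)
  (decode-mark C zero L w len (λ x x∈ → cover (∈-members⁺ C x∈)))
  (∈-cartesianProductWith⁺ decode (∈-bits _)
    (∈-words (λ (b , i) → ∈-cartesianProduct⁺ (∈-bits b) (∈-allFin i)) (mark C zero L origin w)))

-- The upper bound

tour-length : ℕ → ℕ → ℕ
tour-length N d = N + 4 * packing-constant N d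

tour-VC : ∀ {N} → 0 < N → ∀ d → 0 < d → (xs : List (Point N)) → VC≤ d (Member xs) → Tour (tour-length N d) xs
tour-VC {N} N>0 (suc (suc d)) _ xs vc = tour-VC≥2 {{>-nonZero N>0}} (suc (suc d)) (s≤s (s≤s z≤n)) xs vc
-- The tour for dimension 1 has length at most 3N, which fits under the common bound.
tour-VC {N} N>0 1 _ xs vc with w , len , cover ← tour-VC1 xs vc = w , ≤-trans len (+-monoʳ-≤ N (begin
    2 * N                          ≡⟨ cong (2 *_) (*-identityʳ N) ⟨
    2 * N ^ 1                      ≤⟨ *-monoʳ-≤ 2 (m≤n*m (N ^ 1) (4 ^ 4)) ⟩
    2 * (4 ^ 4 * N ^ 1)            ≤⟨ m≤n*m (2 * (4 ^ 4 * N ^ 1)) 4 ⟩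
    4 * packing-constant N 1       ∎)) , cover
  where open ≤-Reasoning

-- There are 2 (2N)^L ≤ N^(2L+1) marked walks, and 2L + 1 ≤ 19 · 4^(4d) · Nᵈ ≤ (19 · 4⁴ · N)ᵈ.
upper-bound : ∀ b → suc b ≡ 19 * 4 ^ 4 → ∀ d → 0 < d → ∀ N → 1 < N → c N d ≤ N ^ ((suc b * N) ^ d)
upper-bound b b≡ d d>0 N N>1 = begin
  c N d                                 ≤⟨ c-upper N d (toured-classes N L) toured ⟩
  length (toured-classes N L)           ≡⟨ length-toured-classes N L ⟩
  2 * (2 * N) ^ L                       ≤⟨ *-mono-≤ N>1 (^-monoˡ-≤ L (*-monoˡ-≤ N N>1)) ⟩
  N * (N * N) ^ L                       ≡⟨ cong (λ t → N * t ^ L) (cong (N *_) (*-identityʳ N)) ⟨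
  N * (N ^ 2) ^ L                       ≡⟨ cong (N *_) (^-*-assoc N 2 L) ⟩
  N ^ suc (2 * L)                       ≤⟨ ^-monoʳ-≤ N {{N≢0}} exponent ⟩
  N ^ ((suc b * N) ^ d)                 ∎
  where
  open ≤-Reasoning
  L = tour-length N d
  F = 4 ^ (4 * d)
  N≢0 : NonZero N
  N≢0 = >-nonZero (<⇒≤ N>1)
  toured : ∀ C → VCdim C ≡ d → C ∈ toured-classes N L
  toured C dim = ∈-toured-classes (<⇒≤ N>1) C (tour-VC (<⇒≤ N>1) d d>0 (members C)
    (subst (λ d → VC≤ d (Member (members C))) dim (VC≤-antitone (∈-members⁻ C) (VCdim⇒VC≤ C))))
  N≤FNᵈ : N ≤ F * N ^ d
  N≤FNᵈ = begin
    N            ≡⟨ *-identityʳ N ⟨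
    N ^ 1        ≤⟨ ^-monoʳ-≤ N {{N≢0}} d>0 ⟩
    N ^ d        ≤⟨ m≤n*m (N ^ d) F {{m^n≢0 4 (4 * d)}} ⟩
    F * N ^ d    ∎
  e₁ : ∀ N X → 1 + 2 * (N + 4 * (2 * X)) ≡ 1 + 2 * N + 16 * X
  e₁ = solve-∀
  e₂ : ∀ X → X + 2 * X + 16 * X ≡ 19 * X
  e₂ = solve-∀
  -- With X = F · Nᵈ, both 1 and N are at most X, so the constant is 19 = 1 + 2 + 16.
  exponent : suc (2 * L) ≤ (suc b * N) ^ d
  exponent = begin
    suc (2 * L)                               ≡⟨ e₁ N (F * N ^ d) ⟩
    1 + 2 * N + 16 * (F * N ^ d)              ≤⟨ +-monoˡ-≤ (16 * (F * N ^ d)) (+-mono-≤ (≤-trans (<⇒≤ N>1) N≤FNᵈ) (*-monoʳ-≤ 2 N≤FNᵈ)) ⟩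
    F * N ^ d + 2 * (F * N ^ d) + 16 * (F * N ^ d)  ≡⟨ e₂ (F * N ^ d) ⟩
    19 * (F * N ^ d)                          ≤⟨ *-monoˡ-≤ (F * N ^ d) (≤-trans (≤-reflexive (sym (*-identityʳ 19))) (^-monoʳ-≤ 19 d>0)) ⟩
    19 ^ d * (F * N ^ d)                      ≡⟨ *-assoc (19 ^ d) F (N ^ d) ⟨
    19 ^ d * F * N ^ d                        ≡⟨ cong (λ t → 19 ^ d * t * N ^ d) (^-*-assoc 4 4 d) ⟨
    19 ^ d * (4 ^ 4) ^ d * N ^ d              ≡⟨ cong (_* N ^ d) (^-distribʳ-* d 19 (4 ^ 4)) ⟨
    (19 * 4 ^ 4) ^ d * N ^ d                  ≡⟨ cong (λ t → t ^ d * N ^ d) b≡ ⟨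
    suc b ^ d * N ^ d                         ≡⟨ ^-distribʳ-* d (suc b) N ⟨
    (suc b * N) ^ d                           ∎

-- The lower bound

VC≤-weaken : ∀ {d d′} {P : Point n → Set} → d ≤ d′ → VC≤ d P → VC≤ d′ P
VC≤-weaken d≤d′ vc Y sh = ≤-trans (vc Y sh) d≤d′

Zeros : ∀ e → (Point n → Set) → Point (e + n) → Set
Zeros zero P x = P x
Zeros (suc e) P (true ∷ x) = ⊥
Zeros (suc e) P (false ∷ x) = Zeros e P x

-- The points eᵢ x with x in P i, and the points 0 x with x in D.
Block : ∀ e → (Fin e → Point n → Set) → (Point n → Set) → Point (e + n) → Set
Block zero P D x = D x
Block (suc e) P D (true ∷ x) = Zeros e (P zero) x
Block (suc e) P D (false ∷ x) = Block e (P ∘ suc) D x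

-- A shattered set cannot meet the block, where the value true never occurs.
VC≤-Zeros : ∀ e {d} {P : Point n → Set} → VC≤ d P → VC≤ d (Zeros e P)
VC≤-Zeros zero vc = vc
VC≤-Zeros (suc e) {d} {P} vc (true ∷ Y) sh with sh (true ∷ replicate _ true)
... | true ∷ x , () , _
... | false ∷ x , _ , () , _
VC≤-Zeros (suc e) {d} {P} vc (false ∷ Y) sh = VC≤-Zeros e vc Y λ p → tail (sh (true ∷ p))
  where
  tail : ∀ {p} → (∃ λ x → Zeros (suc e) P x × Agree (false ∷ Y) x (true ∷ p)) → ∃ λ x → Zeros e P x × Agree Y x p
  tail (false ∷ x , Px , ag) = x , Px , ag

Zeros-mono : ∀ e {P Q : Point n → Set} → (∀ {x} → P x → Q x) → ∀ x → Zeros e P x → Zeros e Q x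
Zeros-mono zero P⊆Q x Px = P⊆Q Px
Zeros-mono (suc e) P⊆Q (false ∷ x) Px = Zeros-mono e P⊆Q x Px

Block-mono : ∀ e {P Q : Fin e → Point n → Set} {D E : Point n → Set} → (∀ i {x} → P i x → Q i x) →
             (∀ {x} → D x → E x) → ∀ x → Block e P D x → Block e Q E x
Block-mono zero P⊆Q D⊆E x Dx = D⊆E Dx
Block-mono (suc e) P⊆Q D⊆E (true ∷ x) = Zeros-mono e (P⊆Q zero) x
Block-mono (suc e) P⊆Q D⊆E (false ∷ x) = Block-mono e (P⊆Q ∘ suc) D⊆E x

Zeros⊆Block : ∀ e {P : Fin e → Point n → Set} {D : Point n → Set} x → Zeros e D x → Block e P D x
Zeros⊆Block zero x Dx = Dx
Zeros⊆Block (suc e) (false ∷ x) Dx = Zeros⊆Block e x Dx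

-- A shattered set has at most one coordinate i in the block, and then the rest is shattered by P i;
-- otherwise the rest is shattered by the union of all P i and D.
VC≤-Block : ∀ e {d} {P : Fin e → Point n → Set} {D U : Point n → Set} → (∀ i → VC≤ d (P i)) → VC≤ (suc d) U →
            (∀ i {x} → P i x → U x) → (∀ {x} → D x → U x) → VC≤ (suc d) (Block e P D)
VC≤-Block zero vcP vcU P⊆U D⊆U = VC≤-antitone D⊆U vcU
VC≤-Block (suc e) {P = P} {D} vcP vcU P⊆U D⊆U (true ∷ Y) sh =
  s≤s (VC≤-Zeros e (vcP zero) Y λ p → tail (sh (true ∷ p)))
  where
  tail : ∀ {p} → (∃ λ x → Block (suc e) P D x × Agree (true ∷ Y) x (true ∷ p)) → ∃ λ x → Zeros e (P zero) x × Agree Y x p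
  tail (true ∷ x , Px , _ , ag) = x , Px , ag
VC≤-Block {n} (suc e) {P = P} {D} vcP vcU P⊆U D⊆U (false ∷ Y) sh =
  VC≤-Block e {D = D∪P₀} (vcP ∘ suc) vcU (P⊆U ∘ suc) D∪P₀⊆U Y λ p → tail (sh (true ∷ p))
  where
  -- Deleting the first coordinate of the block turns its unit vector into 0, so the points of
  -- `P zero` join the default part; this is why the induction carries `D`.
  D∪P₀ : Point n → Set
  D∪P₀ x = D x ⊎ P zero x
  D∪P₀⊆U : ∀ {x} → D∪P₀ x → _
  D∪P₀⊆U (inj₁ Dx) = D⊆U Dx
  D∪P₀⊆U (inj₂ Px) = P⊆U zero Px
  tail : ∀ {p} → (∃ λ x → Block (suc e) P D x × Agree (false ∷ Y) x (true ∷ p)) →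
         ∃ λ x → Block e (P ∘ suc) D∪P₀ x × Agree Y x p
  tail (true ∷ x , Px , ag) = x , Zeros⊆Block e x (Zeros-mono e inj₂ x Px) , ag
  tail (false ∷ x , Px , ag) = x , Block-mono e (λ _ → id) inj₁ x Px , ag

-- Classes in block form

∅ᶜ : ∀ n → Class n
∅ᶜ zero = false
∅ᶜ (suc n) = ∅ᶜ n , ∅ᶜ n

∉-∅ᶜ : (x : Point n) → x ∈ᶜ ∅ᶜ n ≡ false
∉-∅ᶜ [] = refl
∉-∅ᶜ (true ∷ x) = ∉-∅ᶜ x
∉-∅ᶜ (false ∷ x) = ∉-∅ᶜ x

zeros : ∀ e → Class n → Class (e + n)
zeros zero C = C
zeros (suc e) C = ∅ᶜ _ , zeros e C

block : ∀ e → Vec (Class n) e → Class (e + n)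
block zero [] = ∅ᶜ _
block (suc e) (C ∷ Cs) = zeros e C , block e Cs

∈-zeros⁻ : ∀ e (C : Class n) x → ⟦ zeros e C ⟧ x → Zeros e ⟦ C ⟧ x
∈-zeros⁻ zero C x x∈ = x∈
∈-zeros⁻ (suc e) C (true ∷ x) x∈ with () ← trans (sym (∉-∅ᶜ x)) x∈
∈-zeros⁻ (suc e) C (false ∷ x) x∈ = ∈-zeros⁻ e C x x∈

∈-block⁻ : ∀ e (Cs : Vec (Class n) e) x → ⟦ block e Cs ⟧ x → Block e (λ i → ⟦ lookup Cs i ⟧) (λ _ → ⊥) x
∈-block⁻ zero [] x x∈ with () ← trans (sym (∉-∅ᶜ x)) x∈
∈-block⁻ (suc e) (C ∷ Cs) (true ∷ x) x∈ = ∈-zeros⁻ e C x x∈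
∈-block⁻ (suc e) (C ∷ Cs) (false ∷ x) x∈ = ∈-block⁻ e Cs x x∈

∈-zeros⁺ : ∀ e (C : Class n) x → ⟦ C ⟧ x → ⟦ zeros e C ⟧ (replicate e false ++ⱽ x)
∈-zeros⁺ zero C x x∈ = x∈
∈-zeros⁺ (suc e) C x x∈ = ∈-zeros⁺ e C x x∈

zeros-injective : ∀ e {C D : Class n} → zeros e C ≡ zeros e D → C ≡ D
zeros-injective zero eq = eq
zeros-injective (suc e) eq = zeros-injective e (cong proj₂ eq)

block-injective : ∀ e {Cs Ds : Vec (Class n) e} → block e Cs ≡ block e Ds → Cs ≡ Ds
block-injective zero {[]} {[]} eq = refl
block-injective (suc e) {C ∷ Cs} {D ∷ Ds} eq =
  cong₂ _∷_ (zeros-injective e (cong proj₁ eq)) (block-injective e (cong proj₂ eq))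

agree-padded : ∀ e (Y x p : Point n) (z q : Point e) → Agree Y x p → Agree (replicate e false ++ⱽ Y) (z ++ⱽ x) (q ++ⱽ p)
agree-padded zero Y x p [] [] ag = ag
agree-padded (suc e) Y x p (_ ∷ z) (_ ∷ q) ag = agree-padded e Y x p z q ag

∣padded∣ : ∀ e (Y : Subset n) → ∣ replicate e false ++ⱽ Y ∣ ≡ ∣ Y ∣
∣padded∣ zero Y = refl
∣padded∣ (suc e) Y = ∣padded∣ e Y

point : Point n → Class n
point [] = true
point (true ∷ x) = point x , ∅ᶜ _
point (false ∷ x) = ∅ᶜ _ , point x

∈-point⁺ : (x : Point n) → ⟦ point x ⟧ x
∈-point⁺ [] = refl
∈-point⁺ (true ∷ x) = ∈-point⁺ x
∈-point⁺ (false ∷ x) = ∈-point⁺ x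

∈-point⁻ : (x y : Point n) → ⟦ point x ⟧ y → y ≡ x
∈-point⁻ [] [] y∈ = refl
∈-point⁻ (true ∷ x) (true ∷ y) y∈ = cong (true ∷_) (∈-point⁻ x y y∈)
∈-point⁻ (true ∷ x) (false ∷ y) y∈ with () ← trans (sym (∉-∅ᶜ y)) y∈
∈-point⁻ (false ∷ x) (true ∷ y) y∈ with () ← trans (sym (∉-∅ᶜ y)) y∈
∈-point⁻ (false ∷ x) (false ∷ y) y∈ = cong (false ∷_) (∈-point⁻ x y y∈)

point-injective : {x y : Point n} → point x ≡ point y → x ≡ y
point-injective {x = x} {y} eq = ∈-point⁻ y x (subst (λ C → ⟦ C ⟧ x) eq (∈-point⁺ x))

opposite : Point n → Point n
opposite = mapⱽ not

agree-opposite : (Y : Subset n) (x : Point n) → Agree Y x (opposite x) → ∣ Y ∣ ≤ 0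
agree-opposite [] [] ag = z≤n
agree-opposite (true ∷ Y) (true ∷ x) (() , _)
agree-opposite (true ∷ Y) (false ∷ x) (() , _)
agree-opposite (false ∷ Y) (_ ∷ x) ag = agree-opposite Y x ag

-- A point differs from its opposite in every coordinate, so it can realise the opposite pattern on
-- the empty set only.
VC≤0-point : (x : Point n) → VC≤ 0 ⟦ point x ⟧
VC≤0-point x Y sh with y , y∈ , ag ← sh (opposite x) with refl ← ∈-point⁻ x y y∈ = agree-opposite Y x ag

single-injective : {i j : Fin n} → single i ≡ single j → i ≡ j
single-injective {i = zero} {zero} eq = refl
single-injective {i = suc i} {suc j} eq = cong suc (single-injective (proj₂ (∷-injective eq)))

Unit : Point n → Set
Unit x = ∃ λ i → x ≡ single i

agree-zeros-ones : (Y : Subset n) → Agree Y (replicate n false) (replicate n true) → ∣ Y ∣ ≤ 0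
agree-zeros-ones [] ag = z≤n
agree-zeros-ones (false ∷ Y) ag = agree-zeros-ones Y ag

agree-single-ones : (Y : Subset n) (i : Fin n) → Agree Y (single i) (replicate n true) → ∣ Y ∣ ≤ 1
agree-single-ones (true ∷ Y) zero (_ , ag) = s≤s (agree-zeros-ones Y ag)
agree-single-ones (false ∷ Y) zero ag = m≤n⇒m≤1+n (agree-zeros-ones Y ag)
agree-single-ones (false ∷ Y) (suc i) ag = agree-single-ones Y i ag

-- A unit vector agrees with the all-ones pattern in a single coordinate.
VC≤1-Unit : VC≤ {n} 1 Unit
VC≤1-Unit {n} Y sh with _ , (i , refl) , ag ← sh (replicate n true) = agree-single-ones Y i ag

∣∅∣ : ∀ n → ∣ replicate n false ∣ ≡ 0
∣∅∣ zero = refl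
∣∅∣ (suc n) = ∣∅∣ n

words-unique : {A : Set} (L : ℕ) {xs : List A} → Unique xs → Unique (words L xs)
words-unique zero u = [] ∷ []
words-unique (suc L) u = cartesianProductWith⁺ _∷_ ∷-injective u (words-unique L u)

∈-words⁻ : {A : Set} (L : ℕ) {xs : List A} {W : Vec A L} → W ∈ words L xs → ∀ i → lookup W i ∈ xs
∈-words⁻ (suc L) {xs} W∈ with a , W′ , a∈ , W′∈ , refl ← ∈-cartesianProductWith⁻ _∷_ xs (words L xs) W∈ =
  λ { zero → a∈ ; (suc i) → ∈-words⁻ L W′∈ i }

-- The family of block classes

module Family (e₀ M : ℕ) where
  -- Two coordinates per block are needed to shatter the first of them: its value is true on the
  -- first part and false on the second.
  e : ℕ
  e = suc (suc e₀)

  size : ℕ → ℕ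
  size zero = M
  size (suc d) = e + size d

  size≡ : ∀ d → size d ≡ d * e + M
  size≡ zero = refl
  size≡ (suc d) = trans (cong (e +_) (size≡ d)) (sym (+-assoc e (d * e) M))

  -- All strings of `d` unit vectors, one per block, and a final unit vector. Its dimension may
  -- exceed that of a member of the family by one, which is what `VC≤-Block` allows for the union of
  -- the parts.
  Universe : ∀ d → Point (size d) → Set
  Universe zero = Unit
  Universe (suc d) = Block e (λ _ → Universe d) (λ _ → ⊥)

  VC≤-Universe : ∀ d → VC≤ (suc d) (Universe d)
  VC≤-Universe zero = VC≤1-Unit
  VC≤-Universe (suc d) = VC≤-Block e (λ _ → VC≤-Universe d) (VC≤-weaken {P = Universe d} (n≤1+n (suc d)) (VC≤-Universe d)) (λ _ → id) (λ ())

  target : ∀ d → Subset (size d)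
  target zero = replicate M false
  target (suc d) = true ∷ false ∷ replicate e₀ false ++ⱽ target d

  ∣target∣ : ∀ d → ∣ target d ∣ ≡ d
  ∣target∣ zero = ∣∅∣ M
  ∣target∣ (suc d) = cong suc (trans (∣padded∣ e₀ (target d)) (∣target∣ d))

  -- The field `inUniverse` is carried along to control the union of the parts when the next block
  -- is added.
  record Good (d : ℕ) (C : Class (size d)) : Set where
    field
      vc : VC≤ d ⟦ C ⟧
      inUniverse : ∀ {x} → ⟦ C ⟧ x → Universe d x
      shattered : Shatters ⟦ C ⟧ (target d)

  good-point : (i : Fin M) → Good 0 (point (single i))
  good-point i = record
    { vc = VC≤0-point (single i)
    ; inUniverse = λ {x} x∈ → i , ∈-point⁻ (single i) x x∈
    ; shattered = λ p → single i , ∈-point⁺ (single i) , agree-∅ (single i) p }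

  good-block : ∀ d (Cs : Vec (Class (size d)) e) → (∀ i → Good d (lookup Cs i)) → Good (suc d) (block e Cs)
  good-block d Cs@(C₀ ∷ C₁ ∷ _) good = record
    { vc = VC≤-antitone (λ {x} → ∈-block⁻ e Cs x)
             (VC≤-Block e (λ i → Good.vc (good i)) (VC≤-Universe d) (λ i → Good.inUniverse (good i)) (λ ()))
    ; inUniverse = λ {x} x∈ → Block-mono e (λ i → Good.inUniverse (good i)) id x (∈-block⁻ e Cs x x∈)
    ; shattered = pattern-of }
    where
    pattern-of : Shatters ⟦ block e Cs ⟧ (target (suc d))
    -- The required value at the first coordinate selects the part with index 0 or 1, and that part
    -- realises the remaining pattern.
    pattern-of (true ∷ b ∷ p) with splitAt e₀ p
    ... | q , p′ , refl with x , x∈ , ag ← Good.shattered (good zero) p′ =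
      true ∷ false ∷ replicate e₀ false ++ⱽ x , ∈-zeros⁺ e₀ C₀ x x∈ ,
      refl , agree-padded e₀ (target d) x p′ (replicate e₀ false) q ag
    pattern-of (false ∷ b ∷ p) with splitAt e₀ p
    ... | q , p′ , refl with x , x∈ , ag ← Good.shattered (good (suc zero)) p′ =
      false ∷ true ∷ replicate e₀ false ++ⱽ x , ∈-zeros⁺ e₀ C₁ x x∈ ,
      refl , agree-padded e₀ (target d) x p′ (replicate e₀ false) q ag

  family : ∀ d → List (Class (size d))
  family zero = map (point ∘ single) (allFin M)
  family (suc d) = map (block e) (words e (family d))

  length-family : ∀ d → length (family d) ≡ M ^ (e ^ d)
  length-family zero = trans (length-map (point ∘ single) (allFin M)) (trans (length-tabulate {n = M} id) (sym (*-identityʳ M)))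
  length-family (suc d) = trans (length-map (block e) (words e (family d))) (trans (length-words e (family d))
    (trans (cong (_^ e) (length-family d)) (trans (^-*-assoc M (e ^ d) e) (cong (M ^_) (*-comm (e ^ d) e)))))

  family-unique : ∀ d → Unique (family d)
  family-unique zero = map⁺ (single-injective ∘ point-injective) (allFin⁺ M)
  family-unique (suc d) = map⁺ (block-injective e) (words-unique e (family-unique d))

  family-good : ∀ d {C} → C ∈ family d → Good d C
  family-good zero C∈ with i , _ , refl ← ∈-map⁻ (point ∘ single) C∈ = good-point i
  family-good (suc d) C∈ with Cs , Cs∈ , refl ← ∈-map⁻ (block e) C∈ = good-block d Cs λ i → family-good d (∈-words⁻ e Cs∈ i)

  many-classes : ∀ d → M ^ (e ^ d) ≤ c (size d) d
  many-classes d = subst (_≤ c (size d) d) (length-family d) (c-lower (size d) d (family d) (family-unique d) dimension)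
    where
    dimension : ∀ {C} → C ∈ family d → VCdim C ≡ d
    dimension {C} C∈ = ≤-antisym (VC≤⇒VCdim C vc)
      (subst (_≤ VCdim C) (∣target∣ d) (VCdim⇒VC≤ C (target d) shattered))
      where open Good (family-good d C∈)

lower-bound : ∀ d → 0 < d → ∀ N → 4 ≤ N → 8 * d ≤ N → ∀ e → 8 * d * e ≤ N → N ^ (e ^ d) ≤ c N d
lower-bound d d>0 N 4≤N 8d≤N e 8de≤N = begin
  N ^ (e ^ d)              ≤⟨ ^-monoˡ-≤ (e ^ d) N≤M² ⟩
  (M ^ 2) ^ (e ^ d)        ≡⟨ ^-*-assoc M 2 (e ^ d) ⟩
  M ^ (2 * e ^ d)          ≤⟨ ^-monoʳ-≤ M {{M≢0}} exponent ⟩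
  M ^ (E ^ d)              ≤⟨ many-classes d ⟩
  c (size d) d             ≡⟨ cong (λ t → c t d) (trans (size≡ d) (m+[n∸m]≡n dE≤N)) ⟩
  c N d                    ∎
  where
  open ≤-Reasoning
  -- The summand 2 ensures two coordinates per block. The factor 2 gives 2 eᵈ ≤ Eᵈ, which pays for
  -- passing from `N` to `M` by N ≤ 2M ≤ M².
  E = 2 + 2 * e
  M = N ∸ d * E
  open Family (2 * e) M using (size; size≡; many-classes)
  e₁ : ∀ d e → 4 * (d * (2 + 2 * e)) ≡ 8 * d + 8 * d * e
  e₁ = solve-∀
  e₂ : ∀ x → 2 * (2 * x) ≡ 4 * x
  e₂ = solve-∀
  e₃ : ∀ x → x + x ≡ 2 * x
  e₃ = solve-∀
  -- Since 4dE = 8d + 8de, each of the two hypotheses accounts for one `N`.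
  2dE≤N : 2 * (d * E) ≤ N
  2dE≤N = *-cancelˡ-≤ 2 (begin
    2 * (2 * (d * E))      ≡⟨ e₂ (d * E) ⟩
    4 * (d * E)            ≡⟨ e₁ d e ⟩
    8 * d + 8 * d * e      ≤⟨ +-mono-≤ 8d≤N 8de≤N ⟩
    N + N                  ≡⟨ e₃ N ⟩
    2 * N                  ∎)
  dE≤N : d * E ≤ N
  dE≤N = ≤-trans (m≤n*m (d * E) 2) 2dE≤N
  N≤2M : N ≤ 2 * M
  N≤2M = begin
    N                        ≡⟨ m+n∸n≡m N N ⟨
    N + N ∸ N                ≤⟨ ∸-monoʳ-≤ (N + N) 2dE≤N ⟩
    N + N ∸ 2 * (d * E)      ≡⟨ cong (_∸ 2 * (d * E)) (e₃ N) ⟩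
    2 * N ∸ 2 * (d * E)      ≡⟨ *-distribˡ-∸ 2 N (d * E) ⟨
    2 * M                    ∎
  2≤M : 2 ≤ M
  2≤M = *-cancelˡ-≤ 2 (≤-trans 4≤N N≤2M)
  M≢0 : NonZero M
  M≢0 = >-nonZero (<⇒≤ 2≤M)
  N≤M² : N ≤ M ^ 2
  N≤M² = begin
    N           ≤⟨ N≤2M ⟩
    2 * M       ≤⟨ *-monoˡ-≤ M 2≤M ⟩
    M * M       ≡⟨ cong (M *_) (*-identityʳ M) ⟨
    M ^ 2       ∎
  exponent : 2 * e ^ d ≤ E ^ d
  exponent = begin
    2 * e ^ d        ≤⟨ *-monoˡ-≤ (e ^ d) (^-monoʳ-≤ 2 d>0) ⟩
    2 ^ d * e ^ d    ≡⟨ ^-distribʳ-* d 2 e ⟨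
    (2 * e) ^ d      ≤⟨ ^-monoˡ-≤ d (m≤n+m (2 * e) 2) ⟩
    E ^ d            ∎

-- The quantity Ω(N / d) appears as an arbitrary natural number `e` up to N / (suc a · d), which
-- includes the integer part of this quotient.
theorem13 : ∃ λ a → ∃ λ b → ∀ d → 0 < d → ∃ λ N₀ → ∀ N → N₀ < N →
    (∀ e → suc a * d * e ≤ N → N ^ (e ^ d) ≤ c N d) × c N d ≤ N ^ ((suc b * N) ^ d)
-- The constants are 8 = suc 7 and 19 · 4⁴ = 4864 = suc 4863; N₀ = 8d + 4 secures both 8d ≤ N and 4
-- ≤ N.
theorem13 = 7 , 4863 , λ d d>0 → 8 * d + 4 , λ N N₀<N →
  let 8d+4≤N = <⇒≤ N₀<N
      4≤N = ≤-trans (m≤n+m 4 (8 * d)) 8d+4≤N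
      8d≤N = ≤-trans (m≤m+n (8 * d) 4) 8d+4≤N
  in lower-bound d d>0 N 4≤N 8d≤N , upper-bound 4863 refl d d>0 N (≤-trans (s≤s (s≤s z≤n)) 4≤N)
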